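{- Let $S$ be a recurrent specular set on the finite alphabet $A$ (so $A\subset S$). For any finite $S$-maximal bifix code $X$, one has $$\mathrm{Card}(X)=d_X(S)\,(\mathrm{Card}(A)-2)+2,$$ where $d_X(S)$ is the $S$-degree of $X$.
   Context: Words are over a finite alphabet $A$; $\varepsilon$ is the empty word. A set $S$ of words on $A$ is factorial if it contains $A$ and all the factors of its elements. For $w\in S$ let $L(w)=\{a\in A\mid aw\in S\}$, $R(w)=\{a\in A\mid wa\in S\}$, $B(w)=\{(a,b)\in A\times A\mid awb\in S\}$. A factorial set $S$ is biextendable if $B(w)\neq\emptyset$ for all $w\in S$. The extension graph $\mathcal{E}(w)$ is the undirected graph whose vertex set is the disjoint union of $L(w)$ and $R(w)$ and whose edges are the pairs in $B(w)$. A biextendable set $S$ is a tree set of characteristic $c$ if $\mathcal{E}(w)$ is a tree for every nonempty $w\in S$ and $\mathcal{E}(\varepsilon)$ is a disjoint union of $c$ trees. Let $\theta$ be an involution on $A$ (possibly with fixed points) and let $G_\theta$ be the group generated by $A$ with relations $a\theta(a)=1$, $a\in A$ (so $a^{ -1}=\theta(a)$). A word is reduced if it has no factor $a\theta(a)$ with $a\in A$; every element of $G_\theta$ is represented by a unique reduced word, so the inverse of a reduced word $a_1\cdots a_n$ is the reduced word $\theta(a_n)\cdots\theta(a_1)$. A laminary set on $A$ relative to $\theta$ is a biextendable set of reduced words closed under taking inverses. A specular set is a laminary set which is a tree set of characteristic $2$. A set $S\ne\{\varepsilon\}$ is recurrent if it is factorial and for all $u,w\in S$ there is $v\in S$ with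 $uvw\in S$. A bifix code is a set of nonempty words in which no element is a proper prefix or a proper suffix of another. A bifix code $X\subset S$ is $S$-maximal if it is not properly contained in a bifix code $Y\subset S$. A parse of a word $w$ with respect to $X$ is a triple $(q,x,p)$ with $w=qxp$, where $q$ has no suffix in $X$, $x\in X^*$ and $p$ has no prefix in $X$. The $S$-degree $d_X(S)$ is the maximal number of parses with respect to $X$ of a word of $S$. -}

module Defs where

open import Level using (0ℓ)
open import Data.Empty using (⊥)
open import Data.Fin using (Fin)
open import Data.List using (List; []; _∷_; _++_; _∷ʳ_; length; map; reverse; concat)
open import Data.List.Membership.Propositional using (_∈_)
open import Data.List.Relation.Binary.Infix.Heterogeneous using (Infix; here; there)
open import Data.List.Relation.Binary.Prefix.Heterogeneous using (Prefix; []; _∷_)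
open import Data.List.Relation.Binary.Suffix.Heterogeneous using (Suffix)
open import Data.List.Relation.Unary.All using (All)
open import Data.List.Relation.Unary.Linked using (Linked)
open import Data.List.Relation.Unary.Unique.Propositional using (Unique)
open import Data.Nat using (ℕ; _≤_)
open import Data.Product using (_×_; _,_; ∃)
open import Data.Sum using (_⊎_; inj₁; inj₂)
open import Function.Bundles using (_⇔_)
open import Relation.Binary.Construct.Closure.ReflexiveTransitive using (Star)
open import Relation.Binary.Core using (Rel)
open import Relation.Binary.Definitions using (Symmetric)
open import Relation.Binary.PropositionalEquality using (_≡_; refl)
open import Relation.Nullary using (¬_)
open import Relation.Unary using (Pred; _⊆_; _⊂_; _≐_; ｛_｝; _⟨⊎⟩_)

HasCard : {T : Set} → Pred T 0ℓ → ℕ → Set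
HasCard P n = ∃ λ xs → Unique xs × P ≐ (_∈ xs) × length xs ≡ n

-- The vertices of a graph form a subset of an ambient type U, and are compared
-- by the equality of U: membership proofs are not part of a vertex.
record Graph (U : Set) : Set₁ where
  field
    Vertex      : Pred U 0ℓ
    Edge        : Rel U 0ℓ
    edge-sym    : Symmetric Edge
    edge-irrefl : ∀ {u} → ¬ Edge u u
    edge-vertex : ∀ {u v} → Edge u v → Vertex u

module _ {U : Set} where

  Connected : Graph U → Set
  Connected G = ∀ {u v} → Vertex u → Vertex v → Star Edge u v
    where open Graph G

  -- The closed walk v, us, v is a cycle: its vertices are distinct and there
  -- are at least three of them.
  IsCycle : Graph U → U → List U → Set
  IsCycle G v us = 2 ≤ length us × Unique (v ∷ us) × Linked Edge (v ∷ us ∷ʳ v)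
    where open Graph G

  Acyclic : Graph U → Set
  Acyclic G = ∀ v us → ¬ IsCycle G v us

  record IsTree (G : Graph U) : Set where
    field
      nonempty  : ∃ (Graph.Vertex G)
      connected : Connected G
      acyclic   : Acyclic G

  record IsDisjointUnionOfTrees (c : ℕ) (G : Graph U) : Set₁ where
    field
      part     : Fin c → Graph U
      trees    : ∀ i → IsTree (part i)
      disjoint : ∀ {i j u} → Graph.Vertex (part i) u → Graph.Vertex (part j) u → i ≡ j
      vertices : ∀ u → Graph.Vertex G u ⇔ (∃ λ i → Graph.Vertex (part i) u)
      edges    : ∀ u v → Graph.Edge G u v ⇔ (∃ λ i → Graph.Edge (part i) u v)

Word : Set → Set
Word A = List A

module _ {A : Set} where

  record IsFactorial (S : Pred (Word A) 0ℓ) : Set where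
    field
      letters : ∀ a → S (a ∷ [])
      factors : ∀ {u w} → Infix _≡_ u w → S w → S u

  module _ (S : Pred (Word A) 0ℓ) where

    L : Word A → Pred A 0ℓ
    L w a = S (a ∷ w)

    R : Word A → Pred A 0ℓ
    R w b = S (w ∷ʳ b)

    B : Word A → Pred (A × A) 0ℓ
    B w (a , b) = S (a ∷ w ∷ʳ b)

    ExtensionEdge : Word A → Rel (A ⊎ A) 0ℓ
    ExtensionEdge w (inj₁ a) (inj₂ b) = B w (a , b)
    ExtensionEdge w (inj₂ b) (inj₁ a) = B w (a , b)
    ExtensionEdge w (inj₁ _) (inj₁ _) = ⊥
    ExtensionEdge w (inj₂ _) (inj₂ _) = ⊥

    private
      prefix-refl : (w : Word A) → Prefix _≡_ w w
      prefix-refl []      = []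
      prefix-refl (a ∷ w) = refl ∷ prefix-refl w

      prefix-∷ʳ : (w : Word A) (b : A) → Prefix _≡_ w (w ∷ʳ b)
      prefix-∷ʳ []      b = []
      prefix-∷ʳ (a ∷ w) b = refl ∷ prefix-∷ʳ w b

    extensionGraph : IsFactorial S → Word A → Graph (A ⊎ A)
    extensionGraph factorial w = record
      { Vertex      = L w ⟨⊎⟩ R w
      ; Edge        = ExtensionEdge w
      ; edge-sym    = λ {u} {v} → sym′ u v
      ; edge-irrefl = λ {u} → irrefl′ u
      ; edge-vertex = λ {u} {v} → vertex′ u v
      }
      where
      open IsFactorial factorial

      sym′ : ∀ u v → ExtensionEdge w u v → ExtensionEdge w v u
      sym′ (inj₁ _) (inj₂ _) e = e
      sym′ (inj₂ _) (inj₁ _) e = e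

      irrefl′ : ∀ u → ¬ ExtensionEdge w u u
      irrefl′ (inj₁ _) ()
      irrefl′ (inj₂ _) ()

      vertex′ : ∀ u v → ExtensionEdge w u v → (L w ⟨⊎⟩ R w) u
      vertex′ (inj₁ a) (inj₂ b) e = factors (here (refl ∷ prefix-∷ʳ w b)) e
      vertex′ (inj₂ b) (inj₁ a) e = factors (there (here (prefix-refl (w ∷ʳ b)))) e

    record IsBiextendable : Set where
      field
        factorial  : IsFactorial S
        extendable : ∀ {w} → S w → ∃ (B w)

    record IsTreeSet (c : ℕ) : Set₁ where
      field
        biextendable : IsBiextendable
      open IsBiextendable biextendable public
      field
        tree   : ∀ {w} → S w → ¬ w ≡ [] → IsTree (extensionGraph factorial w)
        forest : IsDisjointUnionOfTrees c (extensionGraph factorial [])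

    record IsRecurrent : Set where
      field
        nontrivial : ¬ (S ≐ ｛ [] ｝)
        factorial  : IsFactorial S
        recurrent  : ∀ {u w} → S u → S w → ∃ λ v → S v × S (u ++ v ++ w)

  module _ (θ : A → A) where

    IsReduced : Pred (Word A) 0ℓ
    IsReduced w = ∀ a → ¬ Infix _≡_ (a ∷ θ a ∷ []) w

    -- On reduced words this is inversion in the group ⟨ A ∣ a θ(a) = 1 ⟩,
    -- provided θ is an involution.
    inverse : Word A → Word A
    inverse w = reverse (map θ w)

    record IsLaminary (S : Pred (Word A) 0ℓ) : Set where
      field
        biextendable : IsBiextendable S
        reduced      : S ⊆ IsReduced
        inverses     : ∀ {w} → S w → S (inverse w)

    record IsSpecular (S : Pred (Word A) 0ℓ) : Set₁ where
      field
        laminary : IsLaminary S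
        treeSet  : IsTreeSet S 2

  record IsBifixCode (X : Pred (Word A) 0ℓ) : Set where
    field
      nonempty   : ¬ X []
      prefixCode : ∀ {u v} → X u → X v → Prefix _≡_ u v → u ≡ v
      suffixCode : ∀ {u v} → X u → X v → Suffix _≡_ u v → u ≡ v

  record IsMaximalBifixCode (S X : Pred (Word A) 0ℓ) : Set₁ where
    field
      bifix    : IsBifixCode X
      included : X ⊆ S
      maximal  : ∀ (Y : Pred (Word A) 0ℓ) → IsBifixCode Y → Y ⊆ S → ¬ (X ⊂ Y)

  _⋆ : Pred (Word A) 0ℓ → Pred (Word A) 0ℓ
  (X ⋆) x = ∃ λ ws → All X ws × concat ws ≡ x

  IsParse : Pred (Word A) 0ℓ → Word A → Pred (Word A × Word A × Word A) 0ℓ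
  IsParse X w (q , x , p) =
    w ≡ q ++ x ++ p
    × (∀ {s} → Suffix _≡_ s q → ¬ X s)
    × (X ⋆) x
    × (∀ {s} → Prefix _≡_ s p → ¬ X s)

  record IsDegree (S X : Pred (Word A) 0ℓ) (d : ℕ) : Set where
    field
      attained : ∃ λ w → S w × HasCard (IsParse X w) d
      bound    : ∀ {w n} → S w → HasCard (IsParse X w) n → n ≤ d

{-# OPTIONS --safe #-}
-- Let s be the indicator of S, r(w) = Card R(w) and ρ(w) = r(w) − s(w). Counting the edges of
-- the forests E(w) gives ∑_a ρ(aw) = ρ(w) for w ≠ ε and ∑_a ρ(a) = k − c (here c = 2), so ρ has
-- total mass k − c on the words of each length n ≥ 1. The number δ(w) of parses of w satisfies
-- δ(aw) = δ(w) + π(aw), where π(w) = 1 if w has no prefix in X and π(w) = 0 otherwise.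
-- Summing over the words of length n,
--   ∑ ρδ = (k − c) + ∑_{1 ≤ |w| ≤ n} ρ(w)π(w),   while expanding the prefix tree of X gives
--   Card X = 1 + ∑_{|w| ≤ n} ρ(w)π(w)   for n large.
-- Finally δ is constant, equal to the degree, on long words of S: by maximality and recurrence
-- all long words have a prefix in X, or all have a suffix in X, and in either case recurrence
-- squeezes δ between its monotonicity on one side and its invariance on the other.
-- Constructively one also needs S to be decidable; this follows from the forests E(w).
module Submission where

open import Defs
open import Level using (0ℓ)
open import Algebra.Bundles using (CommutativeMonoid)
open import Algebra.Definitions using (Involutive)
open import Data.Empty using (⊥; ⊥-elim)
open import Data.Fin using (Fin; zero)
import Data.Fin as Fin
open import Data.Integer using (ℤ; +_; 0ℤ; 1ℤ; -1ℤ; _+_; _*_; _-_; -_)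
open import Data.Integer.Properties using (+-identityˡ; +-identityʳ; +-comm; +-assoc; +-injective; +-0-commutativeMonoid; +-0-abelianGroup; -1*i≡-i)
open import Data.Integer.Properties using (*-zeroˡ; *-zeroʳ; *-identityˡ; *-distribˡ-+; *-distribʳ-+)
open import Algebra.Properties.AbelianGroup +-0-abelianGroup using () renaming (∙-cancelˡ to +-cancelˡ)
open import Algebra.Properties.CommutativeSemigroup (CommutativeMonoid.commutativeSemigroup +-0-commutativeMonoid) using (interchange)
open import Data.Integer.Tactic.RingSolver using (solve-∀)
open import Data.List using (List; []; _∷_; _++_; _∷ʳ_; length; map; filter; concat; take; drop; allFin)
open import Data.List using (cartesianProduct; cartesianProductWith; initLast; _∷ʳ′_)
open import Data.List.Extrema.Nat using (max; xs≤max)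
open import Data.List.Membership.DecPropositional using () renaming (_∈?_ to member?)
open import Data.List.Membership.Propositional using (_∈_; _∉_; find; lose)
open import Data.List.Membership.Propositional.Properties using (∈-allFin; ∈-map⁺; ∈-map⁻; ∈-++⁺ˡ; ∈-++⁺ʳ; ∈-++⁻; ∈-filter⁺; ∈-filter⁻; ∈-cartesianProduct⁺; ∈-cartesianProductWith⁺; ∈-cartesianProductWith⁻)
open import Data.List.Membership.Propositional.Properties.WithK using (unique∧set⇒bag)
open import Data.List.Properties using (∷-injective; ++-assoc; ++-identityʳ; ++-cancelˡ; take++drop≡id) renaming (≡-dec to List-≡-dec)
open import Data.List.Properties using (length-tabulate; length-++; length-++-≤ˡ; length-++-≤ʳ; length-map; length-take; length-drop)
open import Data.List.Relation.Binary.BagAndSetEquality using (∼bag⇒↭)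
open import Data.List.Relation.Binary.Infix.Heterogeneous using (Infix; here; there; _++ⁱ_; _ⁱ++_)
open import Data.List.Relation.Binary.Permutation.Propositional.Properties using (↭-length)
open import Data.List.Relation.Binary.Pointwise using (Pointwise-≡⇒≡; ≡⇒Pointwise-≡; []; _∷_)
open import Data.List.Relation.Binary.Prefix.Heterogeneous using (Prefix; []; _∷_; _++ᵖ_)
import Data.List.Relation.Binary.Prefix.Heterogeneous.Properties as Prefix
open import Data.List.Relation.Binary.Suffix.Heterogeneous as Suffix using (Suffix; here; there)
import Data.List.Relation.Binary.Suffix.Heterogeneous.Properties as Suffix
open import Data.List.Relation.Unary.All as All using (All; []; _∷_)
open import Data.List.Relation.Unary.All.Properties as All using (all-filter; All¬⇒¬Any; ¬Any⇒All¬; ¬All⇒Any¬)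
open import Data.List.Relation.Unary.AllPairs as AllPairs using (AllPairs; []; _∷_)
import Data.List.Relation.Unary.AllPairs.Properties as AllPairs
open import Data.List.Relation.Unary.Any as Any using (here; there)
open import Data.List.Relation.Unary.Linked using (Linked; [-]; _∷_)
open import Data.List.Relation.Unary.Unique.Propositional using (Unique)
open import Data.List.Relation.Unary.Unique.Propositional.Properties as Unique using (allFin⁺)
open import Data.List.Reverse using (Reverse; []; _∶_∶ʳ_; reverseView)
open import Data.Nat using (ℕ; zero; suc; s≤s; z≤n; _≤_; _<_)
import Data.Nat as ℕ
open import Data.Nat.Induction using (<-wellFounded)
import Data.Nat.Properties as ℕ
import Data.Nat.Tactic.RingSolver as ℕSolver
open import Data.Product using (∃; _×_; _,_; proj₁; proj₂; swap; uncurry)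
open import Data.Sum as Sum using (_⊎_; inj₁; inj₂; [_,_]′)
open import Data.Sum.Properties using (≡-dec; inj₁-injective; inj₂-injective)
open import Function using (_∘_; id; Equivalence; mk⇔)
open import Induction.WellFounded using (Acc; acc)
open import Relation.Binary.Construct.Closure.ReflexiveTransitive as Star using (Star; ε; _◅_; _◅◅_)
open import Relation.Binary.Core using (Rel; _⇒_)
open import Relation.Binary.Definitions using (DecidableEquality)
open import Relation.Binary.PropositionalEquality using (_≡_; _≢_; refl; sym; trans; cong; cong₂; subst; module ≡-Reasoning)
open import Relation.Nullary using (¬_; Dec; yes; no; contradiction)
open import Relation.Nullary.Decidable using (map′; ¬?; toSum; _→-dec_; decidable-stable)
open import Relation.Unary using (Pred; Decidable; _⊆_; _≐_)
open ≡-Reasoning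

-- Indicators and finite sums of integers.

ι : {P : Set} → Dec P → ℕ
ι (yes _) = 1
ι (no _)  = 0

ι-yes : {P : Set} (P? : Dec P) → P → ι P? ≡ 1
ι-yes (yes _) _ = refl
ι-yes (no ¬p) p = contradiction p ¬p

ι-no : {P : Set} (P? : Dec P) → ¬ P → ι P? ≡ 0
ι-no (yes p) ¬p = contradiction p ¬p
ι-no (no _)  _  = refl

𝟙 : {P : Set} → Dec P → ℤ
𝟙 P? = + ι P?

𝟙-yes : {P : Set} (P? : Dec P) → P → 𝟙 P? ≡ 1ℤ
𝟙-yes P? p = cong +_ (ι-yes P? p)

𝟙-no : {P : Set} (P? : Dec P) → ¬ P → 𝟙 P? ≡ 0ℤ
𝟙-no P? ¬p = cong +_ (ι-no P? ¬p)

∑ : {I : Set} → List I → (I → ℤ) → ℤ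
∑ []       f = 0ℤ
∑ (i ∷ is) f = f i + ∑ is f

module _ {I : Set} where

  ∑-cong : ∀ is {f g : I → ℤ} → (∀ {i} → i ∈ is → f i ≡ g i) → ∑ is f ≡ ∑ is g
  ∑-cong []       f≡g = refl
  ∑-cong (i ∷ is) f≡g = cong₂ _+_ (f≡g (here refl)) (∑-cong is (f≡g ∘ there))

  ∑-zero : ∀ (is : List I) → ∑ is (λ _ → 0ℤ) ≡ 0ℤ
  ∑-zero []       = refl
  ∑-zero (i ∷ is) = trans (+-identityˡ _) (∑-zero is)

  ∑-distrib-+ : ∀ is (f g : I → ℤ) → ∑ is (λ i → f i + g i) ≡ ∑ is f + ∑ is g
  ∑-distrib-+ []       f g = refl
  ∑-distrib-+ (i ∷ is) f g = begin
    f i + g i + ∑ is (λ i → f i + g i)  ≡⟨ cong (λ s → f i + g i + s) (∑-distrib-+ is f g) ⟩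
    f i + g i + (∑ is f + ∑ is g)       ≡⟨ interchange (f i) (g i) _ _ ⟩
    f i + ∑ is f + (g i + ∑ is g)       ∎

  *-distribˡ-∑ : ∀ c is (f : I → ℤ) → c * ∑ is f ≡ ∑ is (λ i → c * f i)
  *-distribˡ-∑ c []       f = *-zeroʳ c
  *-distribˡ-∑ c (i ∷ is) f = trans (*-distribˡ-+ c _ _) (cong (_+_ (c * f i)) (*-distribˡ-∑ c is f))

  ∑-++ : ∀ is js (f : I → ℤ) → ∑ (is ++ js) f ≡ ∑ is f + ∑ js f
  ∑-++ []       js f = sym (+-identityˡ _)
  ∑-++ (i ∷ is) js f = trans (cong (_+_ (f i)) (∑-++ is js f)) (sym (+-assoc (f i) _ _))

  ∑-one : ∀ (is : List I) → ∑ is (λ _ → 1ℤ) ≡ + length is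
  ∑-one []       = refl
  ∑-one (i ∷ is) = cong (_+_ 1ℤ) (∑-one is)

  ∑-filter : ∀ {P : Pred I 0ℓ} (P? : Decidable P) is → + length (filter P? is) ≡ ∑ is (𝟙 ∘ P?)
  ∑-filter P? []       = refl
  ∑-filter P? (i ∷ is) with P? i
  ... | yes _ = cong (_+_ 1ℤ) (∑-filter P? is)
  ... | no _  = trans (∑-filter P? is) (sym (+-identityˡ _))

  module _ (_≟_ : DecidableEquality I) where

    ∑-𝟙-∉ : ∀ {is j} → j ∉ is → ∑ is (λ i → 𝟙 (i ≟ j)) ≡ 0ℤ
    ∑-𝟙-∉ {is} j∉is = trans
      (∑-cong is (λ {i} i∈is → 𝟙-no (i ≟ _) λ { refl → j∉is i∈is })) (∑-zero is)

    ∑-𝟙-∈ : ∀ {is j} → Unique is → j ∈ is → ∑ is (λ i → 𝟙 (i ≟ j)) ≡ 1ℤ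
    ∑-𝟙-∈ {i ∷ is} (i∉is ∷ is!) (here refl) =
      cong₂ _+_ (𝟙-yes (i ≟ i) refl) (∑-𝟙-∉ (All¬⇒¬Any i∉is))
    ∑-𝟙-∈ {i ∷ is} {j} (i∉is ∷ is!) (there j∈is) =
      cong₂ _+_ (𝟙-no (i ≟ j) λ { refl → All¬⇒¬Any i∉is j∈is }) (∑-𝟙-∈ is! j∈is)

module _ {I J : Set} where

  ∑-map : ∀ (h : I → J) is (f : J → ℤ) → ∑ (map h is) f ≡ ∑ is (f ∘ h)
  ∑-map h []       f = refl
  ∑-map h (i ∷ is) f = cong (_+_ (f (h i))) (∑-map h is f)

  ∑-comm : ∀ is js (f : I → J → ℤ) → ∑ is (λ i → ∑ js (f i)) ≡ ∑ js (λ j → ∑ is (λ i → f i j))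
  ∑-comm []       js f = sym (∑-zero js)
  ∑-comm (i ∷ is) js f = trans (cong (_+_ (∑ js (f i))) (∑-comm is js f)) (sym (∑-distrib-+ js _ _))

∑-cartesianProductWith : ∀ {I J K : Set} (h : I → J → K) is js (f : K → ℤ) →
  ∑ (cartesianProductWith h is js) f ≡ ∑ is (λ i → ∑ js (λ j → f (h i j)))
∑-cartesianProductWith h []       js f = refl
∑-cartesianProductWith h (i ∷ is) js f = trans (∑-++ (map (h i) js) _ f)
  (cong₂ _+_ (∑-map (h i) js f) (∑-cartesianProductWith h is js f))

-- Walks in forests, decidability of edges, and the Euler count for a forest.

module _ {U : Set} where

  -- The list of vertices omits the endpoint of the walk.
  data Walk (E : Rel U 0ℓ) : U → List U → U → Set where
    []  : ∀ {v} → Walk E v [] v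
    _∷_ : ∀ {u w us v} → E u w → Walk E w us v → Walk E u (u ∷ us) v

  walk-map : ∀ {E F : Rel U 0ℓ} {u us v} → E ⇒ F → Walk E u us v → Walk F u us v
  walk-map E⇒F []      = []
  walk-map E⇒F (e ∷ p) = E⇒F e ∷ walk-map E⇒F p

  walk⇒linked : ∀ {E : Rel U 0ℓ} {u us v} → Walk E u us v → Linked E (us ∷ʳ v)
  walk⇒linked []            = [-]
  walk⇒linked (e ∷ [])      = e ∷ [-]
  walk⇒linked (e ∷ (f ∷ p)) = e ∷ walk⇒linked (f ∷ p)

  Joined : List (U × U) → Rel U 0ℓ
  Joined es u v = (u , v) ∈ es ⊎ (v , u) ∈ es

  -- An undirected edge is listed as an oriented pair, so its reversal has to be excluded as a
  -- repetition too.
  DistinctEdges : List (U × U) → Set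
  DistinctEdges = AllPairs (λ e f → e ≢ f × e ≢ swap f)

  tree⇒forest : ∀ {G : Graph U} → IsTree G → IsDisjointUnionOfTrees 1 G
  tree⇒forest {G} t = record
    { part     = λ _ → G
    ; trees    = λ _ → t
    ; disjoint = λ { {zero} {zero} _ _ → refl }
    ; vertices = λ _ → mk⇔ (zero ,_) proj₂
    ; edges    = λ _ _ → mk⇔ (zero ,_) proj₂
    }

  module _ (_≟_ : DecidableEquality U) where

    walk-from : ∀ {E : Rel U 0ℓ} {u w us v} → u ∈ us → Walk E w us v → Unique (v ∷ us) →
                ∃ λ us′ → Walk E u us′ v × Unique (v ∷ us′)
    walk-from (here refl) (e ∷ p) !              = _ , e ∷ p , !
    walk-from (there u∈)  (e ∷ p) ((_ ∷ v∉) ∷ (_ ∷ us!)) = walk-from u∈ p (v∉ ∷ us!)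

    -- Put the first edge in front of the simple walk obtained for the rest. If `u` is the endpoint
    -- or already lies on that walk, everything before this occurrence is cut off.
    loop-erase : ∀ {E : Rel U 0ℓ} {u v} → Star E u v → ∃ λ us → Walk E u us v × Unique (v ∷ us)
    loop-erase ε = [] , [] , [] ∷ []
    loop-erase {u = u} {v} (e ◅ es) with loop-erase es
    ... | us , p , v∉us ∷ us! with u ≟ v
    ...   | yes refl = [] , [] , [] ∷ []
    ...   | no u≢v with member? _≟_ u us
    ...     | yes u∈us = walk-from u∈us p (v∉us ∷ us!)
    ...     | no u∉us  = u ∷ us , e ∷ p , ((u≢v ∘ sym) ∷ v∉us) ∷ (¬Any⇒All¬ us u∉us ∷ us!)

    -- A simple path of length at least two cannot be closed by an edge.
    acyclic⇒direct : ∀ (G : Graph U) → Acyclic G → ∀ {E : Rel U 0ℓ} → E ⇒ Graph.Edge G →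
                     ∀ {u v} → u ≢ v → Star E u v → E u v ⊎ ¬ Graph.Edge G u v
    acyclic⇒direct G acyclic E⇒ {u} {v} u≢v es with loop-erase es
    ... | _ , []          , _ = contradiction refl u≢v
    ... | _ , e ∷ []      , _ = inj₁ e
    ... | us , e ∷ (f ∷ p) , ! = inj₂ λ uv →
      acyclic v us (s≤s (s≤s z≤n) , ! , edge-sym uv ∷ walk⇒linked (walk-map E⇒ (e ∷ (f ∷ p))))
      where open Graph G

    module _ {c} (G : Graph U) (forest : IsDisjointUnionOfTrees c G) where
      open Graph G
      open IsDisjointUnionOfTrees forest
      private module Part i = Graph (part i)

      -- The edge lies in some part, and that part contains `u`; disjointness identifies it with the
      -- given one.
      edge-in-part : ∀ {i u v} → Part.Vertex i u → Edge u v → Part.Edge i u v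
      edge-in-part {i} {u} {v} u∈i uv with Equivalence.to (edges u v) uv
      ... | j , uv∈j with refl ← disjoint u∈i (Part.edge-vertex j uv∈j) = uv∈j

      path-in-part : ∀ {i u v} {E : Rel U 0ℓ} → E ⇒ Edge → Part.Vertex i u → Star E u v →
                     Star (λ x y → E x y × Part.Edge i x y) u v × Part.Vertex i v
      path-in-part E⇒ u∈i ε = ε , u∈i
      path-in-part {i} E⇒ u∈i (e ◅ es)
        with uw ← edge-in-part u∈i (E⇒ e)
        with es′ , v∈i ← path-in-part E⇒ (Part.edge-vertex i (Part.edge-sym i uw)) es
        = (e , uw) ◅ es′ , v∈i

      -- A path cannot leave the part in which it starts, so the question reduces to a single tree.
      forest⇒direct : ∀ {E : Rel U 0ℓ} → E ⇒ Edge → ∀ {u v} → Vertex u → u ≢ v →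
                      Star E u v → E u v ⊎ ¬ Edge u v
      forest⇒direct E⇒ {u} {v} u∈G u≢v es with i , u∈i ← Equivalence.to (vertices u) u∈G =
        Sum.map proj₁ (_∘ edge-in-part u∈i)
          (acyclic⇒direct (part i) (IsTree.acyclic (trees i)) proj₂ u≢v (proj₁ (path-in-part E⇒ u∈i es)))

      part-connected : ∀ {i u v} → Part.Vertex i u → Part.Vertex i v → Star Edge u v
      part-connected {i} u∈i v∈i =
        Star.map (λ {x} {y} e → Equivalence.from (edges x y) (i , e)) (IsTree.connected (trees i) u∈i v∈i)

      -- Vertices of different trees are not joined. Within one tree there is a connecting path:
      -- after loop erasure it is either the edge itself, or so long that an edge `u v` would close
      -- a cycle.
      forest-edge? : ∀ {u v} → Vertex u → Vertex v → Dec (Edge u v)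
      forest-edge? {u} {v} u∈G v∈G
        with i , u∈i ← Equivalence.to (vertices u) u∈G | j , v∈j ← Equivalence.to (vertices v) v∈G
        with u ≟ v
      ... | yes refl = no edge-irrefl
      ... | no u≢v with i Fin.≟ j
      ...   | no i≢j   = no λ uv →
                i≢j (disjoint (Part.edge-vertex i (Part.edge-sym i (edge-in-part u∈i uv))) v∈j)
      ...   | yes refl with forest⇒direct id u∈G u≢v (part-connected u∈i v∈j)
      ...     | inj₁ uv  = yes uv
      ...     | inj₂ ¬uv = no ¬uv

    -- Union–find: adding an edge between two classes removes exactly one representative.
    module _ (us : List U) (us! : Unique us) (us-full : ∀ u → u ∈ us) where

      record Components (es : List (U × U)) : Set where
        field
          rep       : U → U
          rep-idem  : ∀ u → rep (rep u) ≡ rep u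
          rep-path  : ∀ u → Star (Joined es) u (rep u)
          rep-edge  : ∀ {u v} → Joined es u v → rep u ≡ rep v
          rep-count : ∑ us (λ u → 𝟙 (rep u ≟ u)) + + length es ≡ + length us

        rep-star : ∀ {u v} → Star (Joined es) u v → rep u ≡ rep v
        rep-star ε        = refl
        rep-star (e ◅ es) = trans (rep-edge e) (rep-star es)

      no-edges : Components []
      no-edges = record
        { rep       = id
        ; rep-idem  = λ _ → refl
        ; rep-path  = λ _ → ε
        ; rep-edge  = λ { (inj₁ ()) ; (inj₂ ()) }
        ; rep-count = trans (+-identityʳ _) (trans (∑-cong us (λ {u} _ → 𝟙-yes (u ≟ u) refl)) (∑-one us))
        }

      module _ {u v es} (C : Components es) (ru≢rv : Components.rep C u ≢ Components.rep C v) where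
        open Components C

        private
          redirect : U → U
          redirect x with x ≟ rep u
          ... | yes _ = rep v
          ... | no _  = x

          redirect-≡ : ∀ {x} → x ≡ rep u → redirect x ≡ rep v
          redirect-≡ {x} x≡ with x ≟ rep u
          ... | yes _ = refl
          ... | no x≢ = contradiction x≡ x≢

          redirect-≢ : ∀ {x} → x ≢ rep u → redirect x ≡ x
          redirect-≢ {x} x≢ with x ≟ rep u
          ... | yes x≡ = contradiction x≡ x≢
          ... | no _   = refl

          weaken : ∀ {x y} → Star (Joined es) x y → Star (Joined ((u , v) ∷ es)) x y
          weaken = Star.map (Sum.map there there)

          idem : ∀ x → redirect (rep (redirect (rep x))) ≡ redirect (rep x)
          idem x with rep x ≟ rep u
          ... | yes _   = trans (redirect-≢ (ru≢rv ∘ sym ∘ trans (sym (rep-idem v)))) (rep-idem v)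
          ... | no rx≢ru = trans (redirect-≢ (rx≢ru ∘ trans (sym (rep-idem x)))) (rep-idem x)

          path : ∀ x → Star (Joined ((u , v) ∷ es)) x (redirect (rep x))
          path x with rep x ≟ rep u
          ... | no _      = weaken (rep-path x)
          -- Go to the old representative of `u`, back to `u`, across the new edge, and on to the
          -- representative of `v`.
          ... | yes rx≡ru = weaken (subst (Star _ x) rx≡ru (rep-path x))
                         ◅◅ weaken (Star.reverse Sum.swap (rep-path u))
                         ◅◅ inj₁ (here refl) ◅ weaken (rep-path v)

          new-edge : redirect (rep u) ≡ redirect (rep v)
          new-edge = trans (redirect-≡ refl) (sym (redirect-≢ (ru≢rv ∘ sym)))

          edge : ∀ {x y} → Joined ((u , v) ∷ es) x y → redirect (rep x) ≡ redirect (rep y)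
          edge (inj₁ (here refl)) = new-edge
          edge (inj₂ (here refl)) = sym new-edge
          edge (inj₁ (there e))   = cong redirect (rep-edge (inj₁ e))
          edge (inj₂ (there e))   = cong redirect (rep-edge (inj₂ e))

          -- Only `rep u` stops being a representative. Any other `x` in the class of `u` was not
          -- one before, and does not become one: it would have to be `rep v`, which lies in the
          -- other class.
          fixed : ∀ x → 𝟙 (rep x ≟ x) ≡ 𝟙 (redirect (rep x) ≟ x) + 𝟙 (x ≟ rep u)
          fixed x with x ≟ rep u
          ... | yes refl = trans (𝟙-yes (rep x ≟ x) (rep-idem u))
                (cong (_+ 1ℤ) (sym (𝟙-no (redirect (rep x) ≟ x)
                  λ eq → ru≢rv (trans (sym eq) (redirect-≡ (rep-idem u))))))
          ... | no x≢ru = trans (lemma (rep x ≟ rep u)) (sym (+-identityʳ _))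
            where
            lemma : Dec (rep x ≡ rep u) → 𝟙 (rep x ≟ x) ≡ 𝟙 (redirect (rep x) ≟ x)
            lemma (no rx≢ru) = cong (λ y → 𝟙 (y ≟ x)) (sym (redirect-≢ rx≢ru))
            lemma (yes rx≡ru) = trans (𝟙-no (rep x ≟ x) λ rx≡x → x≢ru (trans (sym rx≡x) rx≡ru))
              (sym (𝟙-no (redirect (rep x) ≟ x) λ eq →
                ru≢rv (trans (sym rx≡ru) (trans (cong rep (trans (sym eq) (redirect-≡ rx≡ru))) (rep-idem v)))))

          count : ∑ us (λ x → 𝟙 (redirect (rep x) ≟ x)) + + suc (length es) ≡ + length us
          count = begin
            F + (1ℤ + + length es)                          ≡⟨ +-assoc F 1ℤ _ ⟨
            F + 1ℤ + + length es
              ≡⟨ cong (λ s → F + s + + length es) (∑-𝟙-∈ _≟_ us! (us-full (rep u))) ⟨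
            F + ∑ us (λ x → 𝟙 (x ≟ rep u)) + + length es
              ≡⟨ cong (_+ + length es) (∑-distrib-+ us _ _) ⟨
            ∑ us (λ x → 𝟙 (redirect (rep x) ≟ x) + 𝟙 (x ≟ rep u)) + + length es
              ≡⟨ cong (_+ + length es) (∑-cong us (λ {x} _ → fixed x)) ⟨
            ∑ us (λ x → 𝟙 (rep x ≟ x)) + + length es        ≡⟨ rep-count ⟩
            + length us ∎
            where F = ∑ us (λ x → 𝟙 (redirect (rep x) ≟ x))

        add-edge : Components ((u , v) ∷ es)
        add-edge = record
          { rep = redirect ∘ rep ; rep-idem = idem ; rep-path = path ; rep-edge = edge ; rep-count = count }

      module _ {c} (G : Graph U) (forest : IsDisjointUnionOfTrees c G) where
        open Graph G
        open IsDisjointUnionOfTrees forest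
        private module Part i = Graph (part i)

        joined⇒edge : ∀ {es} → All (λ (u , v) → Edge u v) es → Joined es ⇒ Edge
        joined⇒edge es⊆ (inj₁ e) = All.lookup es⊆ e
        joined⇒edge es⊆ (inj₂ e) = edge-sym (All.lookup es⊆ e)

        components : ∀ es → All (λ (u , v) → Edge u v) es → DistinctEdges es → Components es
        components [] [] [] = no-edges
        components ((u , v) ∷ es) (uv ∷ es⊆) (new ∷ es!) = add-edge C ru≢rv
          where
          C = components es es⊆ es!
          open Components C
          u≢v : u ≢ v
          u≢v refl = edge-irrefl uv
          -- If the earlier edges already linked `u` to `v`, then by `forest⇒direct` the pair would
          -- be one of them, against distinctness, or would not be an edge of the forest.
          ru≢rv : rep u ≢ rep v
          ru≢rv ru≡rv with forest⇒direct G forest (joined⇒edge es⊆) (edge-vertex uv) u≢v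
                             (subst (Star _ u) ru≡rv (rep-path u) ◅◅ Star.reverse Sum.swap (rep-path v))
          ... | inj₁ (inj₁ e) = proj₁ (All.lookup new e) refl
          ... | inj₁ (inj₂ e) = proj₂ (All.lookup new e) refl
          ... | inj₂ ¬uv      = ¬uv uv

        -- Once all edges are added, the representatives are one root for each tree together with
        -- every element of `U` outside the graph. Comparing this with `rep-count` gives the Euler
        -- relation. The representative count `F` is added to both sides and cancelled, so nothing
        -- has to be subtracted.
        forest-count : (Vertex? : Decidable Vertex) → ∀ es → All (λ (u , v) → Edge u v) es →
                       DistinctEdges es → Edge ⇒ Joined es →
                       ∑ us (𝟙 ∘ Vertex?) ≡ + c + + length es
        forest-count Vertex? es es⊆ es! full = +-cancelˡ F _ _ (begin
          F + ∑ us (𝟙 ∘ Vertex?)                          ≡⟨ ∑-distrib-+ us _ _ ⟨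
          ∑ us (λ u → 𝟙 (rep u ≟ u) + 𝟙 (Vertex? u))      ≡⟨ ∑-cong us (λ {u} _ → pointwise u) ⟩
          ∑ us (λ u → ∑ (allFin c) (λ i → 𝟙 (u ≟ root i)) + 1ℤ)
                                                          ≡⟨ ∑-distrib-+ us _ _ ⟩
          ∑ us (λ u → ∑ (allFin c) (λ i → 𝟙 (u ≟ root i))) + ∑ us (λ _ → 1ℤ)
                                                          ≡⟨ cong₂ _+_ roots (∑-one us) ⟩
          + c + + length us                               ≡⟨ cong (_+_ (+ c)) rep-count ⟨
          + c + (F + + length es)                         ≡⟨ +-assoc (+ c) F _ ⟨
          + c + F + + length es                           ≡⟨ cong (_+ + length es) (+-comm (+ c) F) ⟩
          F + + c + + length es                           ≡⟨ +-assoc F (+ c) _ ⟩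
          F + (+ c + + length es)                         ∎)
          where
          open Components (components es es⊆ es!)
          F = ∑ us (λ u → 𝟙 (rep u ≟ u))

          root : Fin c → U
          root i = rep (proj₁ (IsTree.nonempty (trees i)))

          rep∈ : ∀ {i u} → Part.Vertex i u → Part.Vertex i (rep u)
          rep∈ u∈i = proj₂ (path-in-part G forest (joined⇒edge es⊆) u∈i (rep-path _))

          root∈ : ∀ i → Part.Vertex i (root i)
          root∈ i = rep∈ (proj₂ (IsTree.nonempty (trees i)))

          isolated : ∀ {u v} → ¬ Vertex u → Star (Joined es) u v → v ≡ u
          isolated u∉G ε       = refl
          isolated u∉G (e ◅ _) = contradiction (edge-vertex (joined⇒edge es⊆ e)) u∉G

          roots : ∑ us (λ u → ∑ (allFin c) (λ i → 𝟙 (u ≟ root i))) ≡ + c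
          roots = begin
            ∑ us (λ u → ∑ (allFin c) (λ i → 𝟙 (u ≟ root i)))  ≡⟨ ∑-comm us (allFin c) _ ⟩
            ∑ (allFin c) (λ i → ∑ us (λ u → 𝟙 (u ≟ root i)))
              ≡⟨ ∑-cong (allFin c) (λ {i} _ → ∑-𝟙-∈ _≟_ us! (us-full (root i))) ⟩
            ∑ (allFin c) (λ _ → 1ℤ)                           ≡⟨ ∑-one (allFin c) ⟩
            + length (allFin c)                               ≡⟨ cong +_ (length-tabulate {n = c} id) ⟩
            + c ∎

          -- An element outside the graph meets no edge, so it represents itself and is no root. A
          -- vertex represents itself exactly when it is the root of its tree.
          pointwise : ∀ u → 𝟙 (rep u ≟ u) + 𝟙 (Vertex? u) ≡ ∑ (allFin c) (λ i → 𝟙 (u ≟ root i)) + 1ℤ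
          pointwise u with Vertex? u
          ... | no u∉G = begin
            𝟙 (rep u ≟ u) + 0ℤ  ≡⟨ cong (_+ 0ℤ) (𝟙-yes (rep u ≟ u) (isolated u∉G (rep-path u))) ⟩
            0ℤ + 1ℤ             ≡⟨ cong (_+ 1ℤ) (trans (∑-cong (allFin c) (λ {i} _ → 𝟙-no (u ≟ root i)
                                     λ { refl → u∉G (Equivalence.from (vertices u) (i , root∈ i)) }))
                                     (∑-zero (allFin c))) ⟨
            ∑ (allFin c) (λ i → 𝟙 (u ≟ root i)) + 1ℤ ∎
          ... | yes u∈G with j , u∈j ← Equivalence.to (vertices u) u∈G with rep u ≟ u
          ...   | no ru≢u = cong (_+ 1ℤ) (sym (trans (∑-cong (allFin c) (λ {i} _ → 𝟙-no (u ≟ root i)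
                              λ { refl → ru≢u (rep-idem _) })) (∑-zero (allFin c))))
          ...   | yes ru≡u = cong (_+ 1ℤ) (sym (trans (∑-cong (allFin c) (λ {i} _ → same i))
                               (∑-𝟙-∈ Fin._≟_ (allFin⁺ c) (∈-allFin j))))
            where
            u≡root : u ≡ root j
            -- Since `es` contains all edges, `u` is linked to the chosen vertex of its tree and
            -- shares its representative.
            u≡root = trans (sym ru≡u) (rep-star (Star.map full
              (part-connected G forest u∈j (proj₂ (IsTree.nonempty (trees j))))))
            same : ∀ i → 𝟙 (u ≟ root i) ≡ 𝟙 (i Fin.≟ j)
            same i with i Fin.≟ j
            ... | yes refl = 𝟙-yes (u ≟ root i) u≡root
            ... | no i≢j   = 𝟙-no (u ≟ root i) λ { refl → i≢j (disjoint (root∈ i) u∈j) }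

-- Sums over words of a given length, and extension counts in a tree set.

rearrange : ∀ b l r c → l + r ≡ c + b → b - l ≡ r - c
rearrange b l r c eq = begin
  b - l            ≡⟨ left b l c ⟩
  (c + b) - l - c  ≡⟨ cong (λ x → x - l - c) eq ⟨
  (l + r) - l - c  ≡⟨ right l r c ⟩
  r - c            ∎
  where
  left : ∀ b l c → b - l ≡ (c + b) - l - c
  left = solve-∀
  right : ∀ l r c → (l + r) - l - c ≡ r - c
  right = solve-∀

infix-refl : ∀ {A : Set} (w : Word A) → Infix _≡_ w w
infix-refl w = here (Prefix.fromPointwise (≡⇒Pointwise-≡ refl))

module _ {A : Set} {S : Pred (Word A) 0ℓ} (factorial : IsFactorial S) where
  open IsFactorial factorial

  drop-++ : ∀ u {w} → S (u ++ w) → S w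
  drop-++ u = factors (u ++ⁱ infix-refl _)

  take-++ : ∀ {u} w → S (u ++ w) → S u
  take-++ w = factors (infix-refl _ ⁱ++ w)

module _ {k : ℕ} where
  private
    A : List (Fin k)
    A = allFin k

  words : ℕ → List (Word (Fin k))
  words zero    = [] ∷ []
  words (suc n) = cartesianProductWith _∷_ A (words n)

  ∈-words⁺ : ∀ w → w ∈ words (length w)
  ∈-words⁺ []      = here refl
  ∈-words⁺ (a ∷ w) = ∈-cartesianProductWith⁺ _∷_ (∈-allFin a) (∈-words⁺ w)

  ∈-words⁻ : ∀ n {w} → w ∈ words n → length w ≡ n
  ∈-words⁻ zero    (here refl) = refl
  ∈-words⁻ (suc n) w∈ with ∈-cartesianProductWith⁻ _∷_ A (words n) w∈
  ... | _ , _ , _ , w∈ , refl = cong suc (∈-words⁻ n w∈)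

  words-unique : ∀ n → Unique (words n)
  words-unique zero    = [] ∷ []
  words-unique (suc n) = Unique.cartesianProductWith⁺ _∷_ ∷-injective (allFin⁺ k) (words-unique n)

  ∑-words-∷ : ∀ n f → ∑ (words (suc n)) f ≡ ∑ (words n) (λ w → ∑ A (λ a → f (a ∷ w)))
  ∑-words-∷ n f = trans (∑-cartesianProductWith _∷_ A (words n) f) (∑-comm A (words n) _)

  -- The lists `words` grow by first letters. Peeling off the first letter, using induction on what
  -- remains and exchanging the two letter sums moves the choice to the last letter.
  ∑-words-∷ʳ : ∀ n f → ∑ (words (suc n)) f ≡ ∑ (words n) (λ w → ∑ A (λ a → f (w ∷ʳ a)))
  ∑-words-∷ʳ zero    f = ∑-words-∷ 0 f
  ∑-words-∷ʳ (suc n) f = begin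
    ∑ (words (suc (suc n))) f                              ≡⟨ ∑-words-∷ (suc n) f ⟩
    ∑ (words (suc n)) (λ w → ∑ A (λ a → f (a ∷ w)))        ≡⟨ ∑-words-∷ʳ n _ ⟩
    ∑ (words n) (λ w → ∑ A (λ b → ∑ A (λ a → f (a ∷ w ∷ʳ b))))
      ≡⟨ ∑-cong (words n) (λ _ → ∑-comm A A _) ⟩
    ∑ (words n) (λ w → ∑ A (λ a → ∑ A (λ b → f (a ∷ w ∷ʳ b))))
      ≡⟨ ∑-words-∷ n _ ⟨
    ∑ (words (suc n)) (λ w → ∑ A (λ b → f (w ∷ʳ b)))       ∎

  private
    infix 4 _≟_
    _≟_ : DecidableEquality (Fin k ⊎ Fin k)
    _≟_ = ≡-dec Fin._≟_ Fin._≟_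

    sides : List (Fin k ⊎ Fin k)
    sides = map inj₁ A ++ map inj₂ A

    sides-unique : Unique sides
    sides-unique = Unique.++⁺ (Unique.map⁺ inj₁-injective (allFin⁺ k)) (Unique.map⁺ inj₂-injective (allFin⁺ k))
      λ { (p , q) → apart (∈-map⁻ inj₁ p) (∈-map⁻ inj₂ q) }
      where
      apart : ∀ {u : Fin k ⊎ Fin k} → (∃ λ a → a ∈ A × u ≡ inj₁ a) → ¬ (∃ λ b → b ∈ A × u ≡ inj₂ b)
      apart (_ , _ , refl) (_ , _ , ())

    sides-full : ∀ u → u ∈ sides
    sides-full (inj₁ a) = ∈-++⁺ˡ (∈-map⁺ inj₁ (∈-allFin a))
    sides-full (inj₂ b) = ∈-++⁺ʳ (map inj₁ A) (∈-map⁺ inj₂ (∈-allFin b))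

  module TreeSet {c} (S : Pred (Word (Fin k)) 0ℓ) (treeSet : IsTreeSet S c) where
    open IsTreeSet treeSet
    open IsFactorial factorial

    extension-forest : ∀ {w} → S w → ∃ λ m → IsDisjointUnionOfTrees m (extensionGraph S factorial w)
    extension-forest {[]}    _  = c , forest
    extension-forest {a ∷ w} Sw = 1 , tree⇒forest (tree Sw λ ())

    -- Membership of awb is decidable: it is an edge between two vertices of a forest.
    language? : S [] → Decidable S
    language? S[] w = by-length (length w) w refl
      where
      length-∷ʳ : ∀ u {b : Fin k} → suc (length u) ≡ length (u ∷ʳ b)
      length-∷ʳ u = trans (ℕ.+-comm 1 (length u)) (sym (length-++ u))

      -- The recursion is on the length because `a ∷ u` is not a subterm of `a ∷ u ∷ʳ b`.
      by-length : ∀ n w → length w ≡ n → Dec (S w)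
      by-length _ [] _ = yes S[]
      by-length (suc n) (a ∷ w) eq with initLast w
      ... | []       = yes (letters a)
      ... | u ∷ʳ′ b with by-length n (a ∷ u) (trans (length-∷ʳ u) (ℕ.suc-injective eq))
                       | by-length n (u ∷ʳ b) (ℕ.suc-injective eq)
      ...   | no ¬au | _ = no (¬au ∘ take-++ factorial (b ∷ []))
      ...   | yes _  | no ¬ub = no (¬ub ∘ drop-++ factorial (a ∷ []))
      ...   | yes au | yes ub =
        forest-edge? _≟_ (extensionGraph S factorial u)
          (proj₂ (extension-forest (drop-++ factorial (a ∷ []) au))) {inj₁ a} {inj₂ b} au ub

    module _ (S? : Decidable S) where

      ∣L∣ ∣R∣ ∣B∣ : Word (Fin k) → ℤ
      ∣L∣ w = ∑ A (λ a → 𝟙 (S? (a ∷ w)))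
      ∣R∣ w = ∑ A (λ b → 𝟙 (S? (w ∷ʳ b)))
      ∣B∣ w = ∑ A (λ a → ∣R∣ (a ∷ w))

      -- This is `forest-count` for the extension graph: the vertex sum splits into left and right
      -- letters, and the edges are the pairs selected by `B?`.
      extension-count : ∀ {w m} → IsDisjointUnionOfTrees m (extensionGraph S factorial w) →
                        ∣L∣ w + ∣R∣ w ≡ + m + ∣B∣ w
      extension-count {w} {m} forest = begin
        ∣L∣ w + ∣R∣ w
          ≡⟨ cong₂ _+_ (∑-map inj₁ A (𝟙 ∘ vertex?)) (∑-map inj₂ A (𝟙 ∘ vertex?)) ⟨
        ∑ (map inj₁ A) (𝟙 ∘ vertex?) + ∑ (map inj₂ A) (𝟙 ∘ vertex?)
          ≡⟨ ∑-++ (map inj₁ A) (map inj₂ A) (𝟙 ∘ vertex?) ⟨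
        ∑ sides (𝟙 ∘ vertex?)
          ≡⟨ forest-count _≟_ sides sides-unique sides-full G forest vertex? es es⊆ es! full ⟩
        + m + + length es
          ≡⟨ cong (λ n → + m + + n) (length-map across (filter B? pairs)) ⟩
        + m + + length (filter B? pairs)
          ≡⟨ cong (_+_ (+ m)) (trans (∑-filter B? pairs) (∑-cartesianProductWith _,_ A A _)) ⟩
        + m + ∣B∣ w ∎
        where
        G = extensionGraph S factorial w
        pairs = cartesianProduct A A

        B? : Decidable (B S w)
        B? (a , b) = S? (a ∷ w ∷ʳ b)

        vertex? : Decidable (Graph.Vertex G)
        vertex? (inj₁ a) = S? (a ∷ w)
        vertex? (inj₂ b) = S? (w ∷ʳ b)

        across : Fin k × Fin k → (Fin k ⊎ Fin k) × (Fin k ⊎ Fin k)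
        across (a , b) = inj₁ a , inj₂ b

        es = map across (filter B? pairs)

        es⊆ : All (λ (u , v) → Graph.Edge G u v) es
        es⊆ = All.map⁺ (all-filter B? pairs)

        es! : DistinctEdges es
        -- Every edge is listed from its left end to its right end, so none is the reversal of
        -- another.
        es! = AllPairs.map⁺ (AllPairs.map (λ e≢f → (λ { refl → e≢f refl }) , λ ())
          (Unique.filter⁺ B? (Unique.cartesianProduct⁺ (allFin⁺ k) (allFin⁺ k))))

        listed : ∀ {a b} → B S w (a , b) → (inj₁ a , inj₂ b) ∈ es
        listed {a} {b} e = ∈-map⁺ across (∈-filter⁺ B? (∈-cartesianProduct⁺ (∈-allFin a) (∈-allFin b)) e)

        full : ∀ {u v} → Graph.Edge G u v → Joined es u v
        full {inj₁ a} {inj₂ b} e = inj₁ (listed e)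
        full {inj₂ b} {inj₁ a} e = inj₂ (listed e)

      ρ : Word (Fin k) → ℤ
      ρ w = ∣R∣ w - 𝟙 (S? w)

      ∑ρ : ∀ w → ∑ A (λ a → ρ (a ∷ w)) ≡ ∣B∣ w - ∣L∣ w
      ∑ρ w = begin
        ∑ A (λ a → ρ (a ∷ w))                          ≡⟨ ∑-distrib-+ A _ _ ⟩
        ∣B∣ w + ∑ A (λ a → - 𝟙 (S? (a ∷ w)))           ≡⟨ cong (_+_ (∣B∣ w)) (∑-cong A (λ _ → -1*i≡-i _)) ⟨
        ∣B∣ w + ∑ A (λ a → -1ℤ * 𝟙 (S? (a ∷ w)))       ≡⟨ cong (_+_ (∣B∣ w)) (*-distribˡ-∑ -1ℤ A _) ⟨
        ∣B∣ w + -1ℤ * ∣L∣ w                            ≡⟨ cong (_+_ (∣B∣ w)) (-1*i≡-i (∣L∣ w)) ⟩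
        ∣B∣ w - ∣L∣ w                                  ∎

      ρ-harmonic : ∀ w → w ≢ [] → ∑ A (λ a → ρ (a ∷ w)) ≡ ρ w
      ρ-harmonic w w≢[] = trans (∑ρ w) (lemma (S? w) refl)
        where
        vanish : ∀ {g : Fin k → Word (Fin k)} → ¬ S w → (∀ a → S (g a) → S w) → ∑ A (λ a → 𝟙 (S? (g a))) ≡ 0ℤ
        vanish ¬Sw up = trans (∑-cong A (λ {a} _ → 𝟙-no (S? _) (¬Sw ∘ up a))) (∑-zero A)
        lemma : (d : Dec (S w)) → S? w ≡ d → ∣B∣ w - ∣L∣ w ≡ ρ w
        lemma (yes Sw) eq rewrite eq =
          rearrange (∣B∣ w) (∣L∣ w) (∣R∣ w) 1ℤ (extension-count (tree⇒forest (tree Sw w≢[])))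
        -- Outside `S` both sides vanish, because by factoriality no extension of `w` lies in `S`.
        lemma (no ¬Sw) eq rewrite eq
          | vanish {λ a → a ∷ w} ¬Sw (λ a → drop-++ factorial (a ∷ []))
          | vanish {w ∷ʳ_} ¬Sw (λ b → take-++ factorial (b ∷ []))
          = trans (+-identityʳ _) (trans (∑-cong A (λ {a} _ →
              vanish {λ b → a ∷ w ∷ʳ b} ¬Sw
                (λ b → take-++ factorial (b ∷ []) ∘ drop-++ factorial (a ∷ [])))) (∑-zero A))

      ρ-letters : ∑ A (λ a → ρ (a ∷ [])) ≡ + k - + c
      ρ-letters = begin
        ∑ A (λ a → ρ (a ∷ []))  ≡⟨ ∑ρ [] ⟩
        ∣B∣ [] - ∣L∣ []         ≡⟨ rearrange (∣B∣ []) (∣L∣ []) (∣R∣ []) (+ c) (extension-count forest) ⟩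
        ∣R∣ [] - + c            ≡⟨ cong (_- + c) all-letters ⟩
        + k - + c               ∎
        where
        all-letters : ∑ A (λ a → 𝟙 (S? (a ∷ []))) ≡ + k
        all-letters = trans (∑-cong A (λ {a} _ → 𝟙-yes (S? (a ∷ [])) (letters a)))
          (trans (∑-one A) (cong +_ (length-tabulate {n = k} id)))

      ρ-∉ : ∀ {w} → ¬ S w → ρ w ≡ 0ℤ
      ρ-∉ {w} ¬Sw rewrite 𝟙-no (S? w) ¬Sw = trans (+-identityʳ _)
        (trans (∑-cong A (λ {b} _ → 𝟙-no (S? (w ∷ʳ b)) (¬Sw ∘ take-++ factorial (b ∷ [])))) (∑-zero A))

-- Uniqueness of cardinality; prefixes, suffixes and splittings of words.

HasCard-unique : ∀ {T : Set} {P : Pred T 0ℓ} {m n} → HasCard P m → HasCard P n → m ≡ n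
HasCard-unique (xs , xs! , (P⊆xs , xs⊆P) , refl) (ys , ys! , (P⊆ys , ys⊆P) , refl) =
  ↭-length (∼bag⇒↭ (unique∧set⇒bag xs! ys! (mk⇔ (P⊆ys ∘ xs⊆P) (P⊆xs ∘ ys⊆P))))

module _ {A : Set} where

  prefix-∷ʳ⁻ : ∀ {u} (w : Word A) {a} → Prefix _≡_ u (w ∷ʳ a) → Prefix _≡_ u w ⊎ u ≡ w ∷ʳ a
  prefix-∷ʳ⁻ []      []          = inj₁ []
  prefix-∷ʳ⁻ []      (refl ∷ []) = inj₂ refl
  prefix-∷ʳ⁻ (b ∷ w) []          = inj₁ []
  prefix-∷ʳ⁻ (b ∷ w) (refl ∷ p)  = Sum.map (refl ∷_) (cong (b ∷_)) (prefix-∷ʳ⁻ w p)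

  suffix-∷⁻ : ∀ {u} {w : Word A} {a} → Suffix _≡_ u (a ∷ w) → Suffix _≡_ u w ⊎ u ≡ a ∷ w
  suffix-∷⁻ (here p)  = inj₂ (Pointwise-≡⇒≡ p)
  suffix-∷⁻ (there p) = inj₁ p

  prefix-refl : (w : Word A) → Prefix _≡_ w w
  prefix-refl w = Prefix.fromPointwise (≡⇒Pointwise-≡ refl)

  prefix-++ : ∀ u {w : Word A} → Prefix _≡_ u (u ++ w)
  prefix-++ u {w} = prefix-refl u ++ᵖ w

  suffix-refl : (w : Word A) → Suffix _≡_ w w
  suffix-refl w = here (≡⇒Pointwise-≡ refl)

  prefix⇒++ : ∀ {u w : Word A} → Prefix _≡_ u w → ∃ λ v → w ≡ u ++ v
  prefix⇒++ []         = _ , refl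
  prefix⇒++ (refl ∷ p) = _ , cong (_ ∷_) (proj₂ (prefix⇒++ p))

  prefix-total : ∀ {u v w : Word A} → Prefix _≡_ u w → Prefix _≡_ v w → Prefix _≡_ u v ⊎ Prefix _≡_ v u
  prefix-total []         _          = inj₁ []
  prefix-total (_ ∷ _)    []         = inj₂ []
  prefix-total (refl ∷ p) (refl ∷ q) = Sum.map (refl ∷_) (refl ∷_) (prefix-total p q)

  prefix-shorter : ∀ {u} v {w : Word A} → Prefix _≡_ u (v ++ w) → length u ≤ length v → Prefix _≡_ u v
  prefix-shorter {[]}    _       _       _         = []
  prefix-shorter {_ ∷ _} (_ ∷ v) (e ∷ p) (s≤s u≤v) = e ∷ prefix-shorter v p u≤v

  suffix-shorter : ∀ {u} v {w : Word A} → Suffix _≡_ u (v ++ w) → length u ≤ length w → Suffix _≡_ u w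
  suffix-shorter []      p         _   = p
  suffix-shorter (a ∷ v) (there p) u≤w = suffix-shorter v p u≤w
  suffix-shorter (a ∷ v) {w} (here p) u≤w with refl ← Pointwise-≡⇒≡ p =
    contradiction u≤w (ℕ.<⇒≱ (s≤s (length-++-≤ʳ w {v})))

  splits : Word A → List (Word A × Word A)
  splits []      = ([] , []) ∷ []
  splits (a ∷ w) = ([] , a ∷ w) ∷ map (λ (q , r) → a ∷ q , r) (splits w)

  ∈-splits⁺ : ∀ q r → (q , r) ∈ splits (q ++ r)
  ∈-splits⁺ []      []      = here refl
  ∈-splits⁺ []      (_ ∷ _) = here refl
  ∈-splits⁺ (a ∷ q) r       = there (∈-map⁺ _ (∈-splits⁺ q r))

  ∈-splits⁻ : ∀ w {q r} → (q , r) ∈ splits w → w ≡ q ++ r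
  ∈-splits⁻ []      (here refl) = refl
  ∈-splits⁻ (a ∷ w) (here refl) = refl
  ∈-splits⁻ (a ∷ w) (there s∈) with ∈-map⁻ _ s∈
  ... | _ , s∈ , refl = cong (a ∷_) (∈-splits⁻ w s∈)

  splits-unique : ∀ w → Unique (splits w)
  splits-unique []      = [] ∷ []
  splits-unique (a ∷ w) = All.map⁺ (All.tabulate λ _ ()) ∷ Unique.map⁺ (λ { refl → refl }) (splits-unique w)

  -- Appending a letter adds one prefix, the whole word; the summand depends only on the prefix
  -- component.
  ∑-splits-∷ʳ : ∀ (f : Word A → ℤ) w a →
                ∑ (splits (w ∷ʳ a)) (f ∘ proj₁) ≡ ∑ (splits w) (f ∘ proj₁) + f (w ∷ʳ a)
  ∑-splits-∷ʳ f []      a = trans (sym (+-assoc (f []) (f (a ∷ [])) 0ℤ))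
    (trans (+-identityʳ (f [] + f (a ∷ []))) (cong (_+ f (a ∷ [])) (sym (+-identityʳ (f [])))))
  ∑-splits-∷ʳ f (b ∷ w) a = begin
    f [] + ∑ (map _ (splits (w ∷ʳ a))) (f ∘ proj₁)
      ≡⟨ cong (_+_ (f [])) (∑-map _ (splits (w ∷ʳ a)) (f ∘ proj₁)) ⟩
    f [] + ∑ (splits (w ∷ʳ a)) (f ∘ (b ∷_) ∘ proj₁)
      ≡⟨ cong (_+_ (f [])) (∑-splits-∷ʳ (f ∘ (b ∷_)) w a) ⟩
    f [] + (∑ (splits w) (f ∘ (b ∷_) ∘ proj₁) + f (b ∷ w ∷ʳ a))
      ≡⟨ +-assoc (f []) _ _ ⟨
    f [] + ∑ (splits w) (f ∘ (b ∷_) ∘ proj₁) + f (b ∷ w ∷ʳ a)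
      ≡⟨ cong (λ s → f [] + s + f (b ∷ w ∷ʳ a)) (∑-map _ (splits w) (f ∘ proj₁)) ⟨
    f [] + ∑ (map _ (splits w)) (f ∘ proj₁) + f (b ∷ w ∷ʳ a) ∎

-- Counting parses with respect to a finite bifix code.

module Code {A : Set} (_≟_ : DecidableEquality A) {X : Pred (Word A) 0ℓ} (bifix : IsBifixCode X)
            (xs : List (Word A)) (X≐xs : X ≐ (_∈ xs)) where
  open IsBifixCode bifix

  X? : Decidable X
  X? w = map′ (proj₂ X≐xs) (proj₁ X≐xs) (member? (List-≡-dec _≟_) w xs)

  HasPrefix HasSuffix : Pred (Word A) 0ℓ
  HasPrefix w = ∃ λ x → X x × Prefix _≡_ x w
  HasSuffix w = ∃ λ x → X x × Suffix _≡_ x w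

  hasPrefix? : Decidable HasPrefix
  hasPrefix? w = map′ (λ p → let x , x∈ , xw = find p in x , proj₂ X≐xs x∈ , xw)
    (λ (x , Xx , xw) → lose (proj₁ X≐xs Xx) xw) (Any.any? (λ x → Prefix.prefix? _≟_ x w) xs)

  hasSuffix? : Decidable HasSuffix
  hasSuffix? w = map′ (λ p → let x , x∈ , xw = find p in x , proj₂ X≐xs x∈ , xw)
    (λ (x , Xx , xw) → lose (proj₁ X≐xs Xx) xw) (Any.any? (λ x → Suffix.suffix? _≟_ x w) xs)

  noPrefix noSuffix : Word A → ℕ
  noPrefix w = ι (¬? (hasPrefix? w))
  noSuffix w = ι (¬? (hasSuffix? w))

  noPrefix-[] : noPrefix [] ≡ 1
  noPrefix-[] = ι-yes (¬? (hasPrefix? [])) λ { ([] , X[] , []) → nonempty X[] }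

  noSuffix-[] : noSuffix [] ≡ 1
  noSuffix-[] = ι-yes (¬? (hasSuffix? [])) λ { ([] , X[] , here []) → nonempty X[] }

  -- The only prefix of `w ∷ʳ a` that is not one of `w` is the whole word. It cannot be a codeword
  -- when `w` already has a prefix in `X`, since `X` is a prefix code.
  noPrefix-∷ʳ : ∀ w a → noPrefix (w ∷ʳ a) ℕ.+ ι (X? (w ∷ʳ a)) ≡ noPrefix w
  noPrefix-∷ʳ w a with hasPrefix? w | X? (w ∷ʳ a)
  ... | yes (x , Xx , xw) | yes Xwa = contradiction
        (subst (λ y → length y ≤ length w) (prefixCode Xx Xwa (xw ++ᵖ (a ∷ []))) (Prefix.length-mono xw))
        (ℕ.<⇒≱ (ℕ.≤-reflexive (trans (ℕ.+-comm 1 (length w)) (sym (length-++ w)))))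
  ... | yes (x , Xx , xw) | no _ = trans (ℕ.+-identityʳ _)
        (ι-no (¬? (hasPrefix? (w ∷ʳ a))) λ ¬p → ¬p (x , Xx , xw ++ᵖ (a ∷ [])))
  ... | no _ | yes Xwa = cong (ℕ._+ 1)
        (ι-no (¬? (hasPrefix? (w ∷ʳ a))) λ ¬p → ¬p (w ∷ʳ a , Xwa , prefix-refl _))
  ... | no ¬p | no ¬Xwa = trans (ℕ.+-identityʳ _)
        (ι-yes (¬? (hasPrefix? (w ∷ʳ a))) λ (x , Xx , xwa) →
          [ (λ xw → ¬p (x , Xx , xw)) , (λ x≡wa → ¬Xwa (subst X x≡wa Xx)) ]′ (prefix-∷ʳ⁻ w xwa))

  noSuffix-∷ : ∀ a w → noSuffix (a ∷ w) ℕ.+ ι (X? (a ∷ w)) ≡ noSuffix w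
  noSuffix-∷ a w with hasSuffix? w | X? (a ∷ w)
  ... | yes (x , Xx , xw) | yes Xaw = contradiction
        (subst (λ y → length y ≤ length w) (suffixCode Xx Xaw (there xw)) (Suffix.length-mono xw))
        (ℕ.<⇒≱ ℕ.≤-refl)
  ... | yes (x , Xx , xw) | no _ = trans (ℕ.+-identityʳ _)
        (ι-no (¬? (hasSuffix? (a ∷ w))) λ ¬p → ¬p (x , Xx , there xw))
  ... | no _ | yes Xaw = cong (ℕ._+ 1)
        (ι-no (¬? (hasSuffix? (a ∷ w))) λ ¬p → ¬p (a ∷ w , Xaw , suffix-refl _))
  ... | no ¬p | no ¬Xaw = trans (ℕ.+-identityʳ _)
        (ι-yes (¬? (hasSuffix? (a ∷ w))) λ (x , Xx , xaw) →
          [ (λ xw → ¬p (x , Xx , xw)) , (λ x≡aw → ¬Xaw (subst X x≡aw Xx)) ]′ (suffix-∷⁻ xaw))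

  -- The parses of w correspond to its suffixes p without prefix in X, and also to its
  -- prefixes q without suffix in X; hence the two recursions, on either side of w.
  δ : Word A → ℕ
  δ []      = 1
  δ (a ∷ w) = noPrefix (a ∷ w) ℕ.+ δ w

  -- Let `b w a` be the whole word. Passing to it from `b w` lowers `noPrefix`, and passing to it
  -- from `w a` lowers `noSuffix`, by the same amount: one if it is a codeword, zero otherwise.
  -- Exchanging these two defects carries the induction.
  δ-∷ʳ : ∀ w a → δ (w ∷ʳ a) ≡ δ w ℕ.+ noSuffix (w ∷ʳ a)
  δ-∷ʳ []      a = trans (ℕ.+-comm _ 1) (cong suc (ℕ.+-cancelʳ-≡ (ι (X? (a ∷ []))) _ _
    (trans (trans (noPrefix-∷ʳ [] a) noPrefix-[]) (sym (trans (noSuffix-∷ a []) noSuffix-[])))))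
  δ-∷ʳ (b ∷ w) a = begin
    noPrefix (b ∷ w ∷ʳ a) ℕ.+ δ (w ∷ʳ a)
      ≡⟨ cong (noPrefix (b ∷ w ∷ʳ a) ℕ.+_) (δ-∷ʳ w a) ⟩
    noPrefix (b ∷ w ∷ʳ a) ℕ.+ (δ w ℕ.+ noSuffix (w ∷ʳ a))
      ≡⟨ cong (λ s → noPrefix (b ∷ w ∷ʳ a) ℕ.+ (δ w ℕ.+ s)) (noSuffix-∷ b (w ∷ʳ a)) ⟨
    noPrefix (b ∷ w ∷ʳ a) ℕ.+ (δ w ℕ.+ (noSuffix (b ∷ w ∷ʳ a) ℕ.+ ι (X? (b ∷ w ∷ʳ a))))
      ≡⟨ regroup (noPrefix (b ∷ w ∷ʳ a)) (δ w) (noSuffix (b ∷ w ∷ʳ a)) _ ⟩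
    noPrefix (b ∷ w ∷ʳ a) ℕ.+ ι (X? (b ∷ w ∷ʳ a)) ℕ.+ δ w ℕ.+ noSuffix (b ∷ w ∷ʳ a)
      ≡⟨ cong (λ p → p ℕ.+ δ w ℕ.+ noSuffix (b ∷ w ∷ʳ a)) (noPrefix-∷ʳ (b ∷ w) a) ⟩
    noPrefix (b ∷ w) ℕ.+ δ w ℕ.+ noSuffix (b ∷ w ∷ʳ a) ∎
    where
    regroup : ∀ p d s x → p ℕ.+ (d ℕ.+ (s ℕ.+ x)) ≡ p ℕ.+ x ℕ.+ d ℕ.+ s
    regroup = ℕSolver.solve-∀

  δ-monoˡ : ∀ u w → δ w ≤ δ (u ++ w)
  δ-monoˡ []      w = ℕ.≤-refl
  δ-monoˡ (a ∷ u) w = ℕ.≤-trans (δ-monoˡ u w) (ℕ.m≤n+m _ _)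

  δ-monoʳ : ∀ u w → δ u ≤ δ (u ++ w)
  δ-monoʳ u []      = ℕ.≤-reflexive (cong δ (sym (++-identityʳ u)))
  δ-monoʳ u (a ∷ w) = ℕ.≤-trans (subst (δ u ≤_) (sym (δ-∷ʳ u a)) (ℕ.m≤m+n _ _))
    (subst (λ v → δ (u ∷ʳ a) ≤ δ v) (++-assoc u (a ∷ []) w) (δ-monoʳ (u ∷ʳ a) w))

  ∑-splits-noSuffix : ∀ w → ∑ (splits w) (λ (q , _) → + noSuffix q) ≡ + δ w
  ∑-splits-noSuffix w = go (reverseView w)
    where
    go : ∀ {w} → Reverse w → ∑ (splits w) (λ (q , _) → + noSuffix q) ≡ + δ w
    go []             = trans (+-identityʳ _) (cong +_ noSuffix-[])
    go (w ∶ rs ∶ʳ a) = trans (∑-splits-∷ʳ (+_ ∘ noSuffix) w a)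
      (trans (cong (_+ + noSuffix (w ∷ʳ a)) (go rs)) (cong +_ (sym (δ-∷ʳ w a))))

  Decoding : Word A → Word A × Word A → Set
  Decoding r (x , p) = r ≡ x ++ p × (X ⋆) x × (∀ {s} → Prefix _≡_ s p → ¬ X s)

  -- Codewords are removed from the left as long as possible; they are nonempty, so the length
  -- decreases.
  decode : ∀ r → ∃ (Decoding r)
  decode r = go r (<-wellFounded (length r))
    where
    go : ∀ r → Acc _<_ (length r) → ∃ (Decoding r)
    go r (acc rec) with hasPrefix? r
    ... | no ¬p = ([] , r) , refl , ([] , [] , refl) , λ {s} sp Xs → ¬p (s , Xs , sp)
    ... | yes ([] , X[] , _) = contradiction X[] nonempty
    ... | yes (a ∷ y , Xy , yr) with v , refl ← prefix⇒++ yr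
        with (x , p) , refl , (ws , Xws , refl) , np ← go v (rec (s≤s (length-++-≤ʳ v {y})))
        = (a ∷ y ++ x , p) , sym (++-assoc (a ∷ y) x p) , ((a ∷ y) ∷ ws , Xy ∷ Xws , refl) , np

  -- Two first codewords are prefixes of the same word, hence comparable, hence equal in a prefix
  -- code. If one factorization stops earlier, its remainder starts with a codeword, which is
  -- excluded.
  decode-unique : ∀ {r d e} → Decoding r d → Decoding r e → d ≡ e
  decode-unique (refl , (ws , Xws , refl) , np) (eq , (ws′ , Xws′ , refl) , np′) = go Xws Xws′ eq np np′
    where
    go : ∀ {ws ws′ p p′} → All X ws → All X ws′ → concat ws ++ p ≡ concat ws′ ++ p′ →
         (∀ {s} → Prefix _≡_ s p → ¬ X s) → (∀ {s} → Prefix _≡_ s p′ → ¬ X s) →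
         (concat ws , p) ≡ (concat ws′ , p′)
    go [] [] refl _ _ = refl
    go {ws′ = y ∷ ws′} [] (Xy ∷ _) refl np _ =
      contradiction Xy (np (prefix-++ y ++ᵖ _))
    go {ws = y ∷ ws} (Xy ∷ _) [] refl _ np′ =
      contradiction Xy (np′ (prefix-++ y ++ᵖ _))
    go {ws = y ∷ ws} {y′ ∷ ws′} {p} {p′} (Xy ∷ Xws) (Xy′ ∷ Xws′) eq np np′ with y≡y′
      where
      y≡y′ : y ≡ y′
      y≡y′ = [ prefixCode Xy Xy′ , sym ∘ prefixCode Xy′ Xy ]′ (prefix-total
        (prefix-++ y ++ᵖ p) (subst (Prefix _≡_ y′) (sym eq) (prefix-++ y′ ++ᵖ p′)))
    ... | refl with go Xws Xws′ (++-cancelˡ y _ _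
                      (trans (sym (++-assoc y (concat ws) p)) (trans eq (++-assoc y (concat ws′) p′)))) np np′
    ...   | eq′ = cong (λ (x , p) → y ++ x , p) eq′

  -- A parse is determined by its first component: what follows it decodes in exactly one way. So
  -- the parses match the prefixes of `w` without suffix in `X`, which `∑-splits-noSuffix` counts.
  parse-count : ∀ w → HasCard (IsParse X w) (δ w)
  parse-count w = map parse admissible , unique , (complete , sound) , count
    where
    noSuffix? : Decidable {A = Word A × Word A} (λ (q , _) → ¬ HasSuffix q)
    noSuffix? (q , _) = ¬? (hasSuffix? q)

    parse : Word A × Word A → Word A × Word A × Word A
    parse (q , r) = q , proj₁ (decode r)

    admissible : List (Word A × Word A)
    admissible = filter noSuffix? (splits w)

    parse-injective : ∀ {s t} → parse s ≡ parse t → s ≡ t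
    parse-injective {q , r} {q′ , r′} eq = cong₂ _,_ (cong proj₁ eq)
      (trans (proj₁ (proj₂ (decode r)))
        (trans (cong (uncurry _++_ ∘ proj₂) eq) (sym (proj₁ (proj₂ (decode r′))))))

    unique : Unique (map parse admissible)
    unique = Unique.map⁺ parse-injective (Unique.filter⁺ noSuffix? (splits-unique w))

    complete : ∀ {t} → IsParse X w t → t ∈ map parse admissible
    complete {q , x , p} (refl , ns , Xx , np) =
      subst (_∈ map parse admissible) (cong (q ,_) (decode-unique (proj₂ (decode (x ++ p))) (refl , Xx , np)))
        (∈-map⁺ parse (∈-filter⁺ noSuffix? (∈-splits⁺ q (x ++ p)) λ (s , Xs , sq) → ns sq Xs))

    sound : ∀ {t} → t ∈ map parse admissible → IsParse X w t
    sound t∈ with (q , r) , s∈ , refl ← ∈-map⁻ parse t∈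
      with s∈ , ns ← ∈-filter⁻ noSuffix? {xs = splits w} s∈
      with _ , eq , Xx , np ← decode r =
      trans (∈-splits⁻ w s∈) (cong (q ++_) eq) , (λ {s} sq Xs → ns (s , Xs , sq)) , Xx , np

    count : length (map parse admissible) ≡ δ w
    count = +-injective (trans (cong +_ (length-map parse admissible))
      (trans (∑-filter noSuffix? (splits w)) (∑-splits-noSuffix w)))

-- Maximality, recurrence and the constancy of the parse count.

module Maximal {k} {S X : Pred (Word (Fin k)) 0ℓ} (S? : Decidable S) (biextendable : IsBiextendable S)
               (isRecurrent : IsRecurrent S) (isMaximal : IsMaximalBifixCode S X)
               (xs : List (Word (Fin k))) (X≐xs : X ≐ (_∈ xs)) where
  open IsBiextendable biextendable
  open IsRecurrent isRecurrent using (recurrent)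
  open IsMaximalBifixCode isMaximal
  open Code Fin._≟_ bifix xs X≐xs

  -- The successor makes the bound on codeword lengths strict, and keeps it positive even if `X` is
  -- empty.
  N : ℕ
  N = suc (max 0 (map length xs))

  X-short : ∀ {x} → X x → length x < N
  X-short Xx = s≤s (All.lookup (All.map⁻ (xs≤max 0 (map length xs))) (proj₁ X≐xs Xx))

  PrefixComplete SuffixComplete : Set
  PrefixComplete = ∀ {w} → S w → N ≤ length w → HasPrefix w
  SuffixComplete = ∀ {w} → S w → N ≤ length w → HasSuffix w

  -- Recurrence gives a word `y` of `S` that begins with `u` and ends with `w`. It is longer than
  -- all codewords, and a codeword at its beginning or end would fit inside `u` or `w`. So `y` could
  -- be added to `X`, against maximality.
  not-both-incomplete : ∀ {u w} → S u → N ≤ length u → ¬ HasPrefix u →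
                        S w → N ≤ length w → ¬ HasSuffix w → ⊥
  not-both-incomplete {u} {w} Su N≤u np Sw N≤w ns with v , _ , Sy ← recurrent Su Sw =
    maximal Y Y-bifix [ included , (λ { refl → Sy }) ]′ (inj₁ , λ Y⊆X → ¬Xy (Y⊆X (inj₂ refl)))
    where
    y = u ++ v ++ w
    N≤y : N ≤ length y
    N≤y = ℕ.≤-trans N≤u (length-++-≤ˡ u)
    long : ∀ {x} → X x → length x < length y
    long Xx = ℕ.≤-trans (X-short Xx) N≤y
    ¬Xy : ¬ X y
    ¬Xy Xy = ℕ.<-irrefl refl (long Xy)
    Y : Pred (Word (Fin k)) 0ℓ
    Y z = X z ⊎ z ≡ y
    Y-bifix : IsBifixCode Y
    Y-bifix = record { nonempty = Y-nonempty ; prefixCode = Y-prefix ; suffixCode = Y-suffix }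
      where
      Y-nonempty : ¬ Y []
      Y-nonempty (inj₁ X[]) = IsBifixCode.nonempty bifix X[]
      Y-nonempty (inj₂ []≡y) with () ← subst (λ z → N ≤ length z) (sym []≡y) N≤y
      Y-prefix : ∀ {z z′} → Y z → Y z′ → Prefix _≡_ z z′ → z ≡ z′
      Y-prefix (inj₁ Xz) (inj₁ Xz′) p = IsBifixCode.prefixCode bifix Xz Xz′ p
      Y-prefix (inj₁ Xz) (inj₂ refl) p =
        contradiction (_ , Xz , prefix-shorter u p (ℕ.≤-trans (ℕ.<⇒≤ (X-short Xz)) N≤u)) np
      Y-prefix (inj₂ refl) (inj₁ Xz′) p = contradiction (Prefix.length-mono p) (ℕ.<⇒≱ (long Xz′))
      Y-prefix (inj₂ refl) (inj₂ refl) p = refl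
      Y-suffix : ∀ {z z′} → Y z → Y z′ → Suffix _≡_ z z′ → z ≡ z′
      Y-suffix (inj₁ Xz) (inj₁ Xz′) p = IsBifixCode.suffixCode bifix Xz Xz′ p
      Y-suffix (inj₁ Xz) (inj₂ refl) p = contradiction (_ , Xz , suffix-shorter v
        (suffix-shorter u p (ℕ.≤-trans (ℕ.<⇒≤ (X-short Xz)) (ℕ.≤-trans N≤w
          (length-++-≤ʳ w {v}))))
        (ℕ.≤-trans (ℕ.<⇒≤ (X-short Xz)) N≤w)) ns
      Y-suffix (inj₂ refl) (inj₁ Xz′) p = contradiction (Suffix.length-mono p) (ℕ.<⇒≱ (long Xz′))
      Y-suffix (inj₂ refl) (inj₂ refl) p = refl

  -- There are finitely many words of length `N` and `S` is decidable, so the alternative is settled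
  -- without excluded middle.
  search : ∀ {Q : Pred (Word (Fin k)) 0ℓ} → Decidable Q →
           (∀ {w} → S w → length w ≡ N → Q w) ⊎ (∃ λ w → S w × length w ≡ N × ¬ Q w)
  search Q? with All.all? (λ w → S? w →-dec Q? w) (words N)
  ... | yes all = inj₁ λ {w} Sw eq → All.lookup all (subst (λ n → w ∈ words n) eq (∈-words⁺ w)) Sw
  ... | no ¬all with find (¬All⇒Any¬ (λ w → S? w →-dec Q? w) (words N) ¬all)
  ...   | w , w∈ , ¬SQ = inj₂ (w , decidable-stable (S? w) (λ ¬Sw → ¬SQ λ Sw → contradiction Sw ¬Sw)
                            , ∈-words⁻ N w∈ , λ Qw → ¬SQ λ _ → Qw)

  -- Testing length `N` is enough: a longer word inherits a codeword prefix from its first `N`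
  -- letters, and a codeword suffix from its last `N`.
  complete : PrefixComplete ⊎ SuffixComplete
  complete with search hasPrefix? | search hasSuffix?
  ... | inj₁ all | _ = inj₁ λ {w} Sw N≤w →
        let S′ = subst S (sym (take++drop≡id N w)) Sw
            x , Xx , p = all (take-++ factorial (drop N w) S′)
                             (trans (length-take N w) (ℕ.m≤n⇒m⊓n≡m N≤w))
        in x , Xx , subst (Prefix _≡_ x) (take++drop≡id N w) (p ++ᵖ drop N w)
  ... | inj₂ _ | inj₁ all = inj₂ λ {w} Sw N≤w →
        let m = length w ℕ.∸ N
            S′ = subst S (sym (take++drop≡id m w)) Sw
            x , Xx , p = all (drop-++ factorial (take m w) S′)
                             (trans (length-drop m w) (ℕ.m∸[m∸n]≡n N≤w))
        in x , Xx , subst (Suffix _≡_ x) (take++drop≡id m w) (take m w Suffix.++ˢ p)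
  ... | inj₂ (u , Su , eq , np) | inj₂ (w , Sw , eq′ , ns) =
        ⊥-elim (not-both-incomplete Su (ℕ.≤-reflexive (sym eq)) np Sw (ℕ.≤-reflexive (sym eq′)) ns)

  -- In `δ-peak` the word `u` may be short: this gives the bound required of the degree, while
  -- constancy on long words follows by symmetry.
  record Stable (M : ℕ) : Set where
    field
      δ-peak     : ∀ {u w} → S u → S w → M ≤ length w → δ u ≤ δ w
      noPrefix≡0 : ∀ {w} → S w → M ≤ length w → noPrefix w ≡ 0

    δ-constant : ∀ {u w} → S u → M ≤ length u → S w → M ≤ length w → δ u ≡ δ w
    δ-constant Su M≤u Sw M≤w = ℕ.≤-antisym (δ-peak Su Sw M≤w) (δ-peak Sw Su M≤u)

  -- If every long word of S has a prefix in X, extending a long word to the left keeps δ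
  -- constant, while extending it to the right never decreases δ.
  prefix-stable : PrefixComplete → Stable N
  prefix-stable pc = record { δ-peak = peak ; noPrefix≡0 = none }
    where
    none : ∀ {w} → S w → N ≤ length w → noPrefix w ≡ 0
    none {w} Sw N≤w = ι-no (¬? (hasPrefix? w)) λ np → np (pc Sw N≤w)
    absorb : ∀ u {w} → S (u ++ w) → N ≤ length w → δ (u ++ w) ≡ δ w
    absorb []      _   _   = refl
    absorb (a ∷ u) {w} Suw N≤w = trans
      (cong (ℕ._+ δ (u ++ w)) (none Suw (ℕ.≤-trans N≤w (length-++-≤ʳ w {a ∷ u}))))
      (absorb u (drop-++ factorial (a ∷ []) Suw) N≤w)
    peak : ∀ {u w} → S u → S w → N ≤ length w → δ u ≤ δ w
    peak {u} {w} Su Sw N≤w with v , _ , Suvw ← recurrent Su Sw =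
      subst (δ u ≤_) (trans (cong δ (sym (++-assoc u v w)))
        (absorb (u ++ v) (subst S (sym (++-assoc u v w)) Suvw) N≤w)) (δ-monoʳ u (v ++ w))

  -- Here extension to the right keeps δ constant and extension to the left does not decrease it.
  -- For `noPrefix`, compare `a ∷ w` with `w`: the peak property forces δ to agree on them, so their
  -- difference `noPrefix (a ∷ w)` is zero. The tail must itself be long, hence `suc N`.
  suffix-stable : SuffixComplete → Stable (suc N)
  suffix-stable sc = record
    { δ-peak = λ Su Sw N<w → peak Su Sw (ℕ.<⇒≤ N<w) ; noPrefix≡0 = none }
    where
    absorb : ∀ u w → S (u ++ w) → N ≤ length u → δ (u ++ w) ≡ δ u
    absorb u []      _   _   = cong δ (++-identityʳ u)
    absorb u (a ∷ w) Suw N≤u = begin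
      δ (u ++ a ∷ w)                ≡⟨ cong δ (++-assoc u (a ∷ []) w) ⟨
      δ (u ∷ʳ a ++ w)               ≡⟨ absorb (u ∷ʳ a) w Suw′ N≤ua ⟩
      δ (u ∷ʳ a)                    ≡⟨ δ-∷ʳ u a ⟩
      δ u ℕ.+ noSuffix (u ∷ʳ a)     ≡⟨ cong (δ u ℕ.+_) (ι-no (¬? (hasSuffix? (u ∷ʳ a)))
                                         λ ns → ns (sc (take-++ factorial w Suw′) N≤ua)) ⟩
      δ u ℕ.+ 0                     ≡⟨ ℕ.+-identityʳ _ ⟩
      δ u                           ∎
      where
      Suw′ = subst S (sym (++-assoc u (a ∷ []) w)) Suw
      N≤ua = ℕ.≤-trans N≤u (length-++-≤ˡ u)
    peak : ∀ {u w} → S u → S w → N ≤ length w → δ u ≤ δ w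
    peak {u} {w} Su Sw N≤w with v , _ , Swvu ← recurrent Sw Su =
      subst (δ u ≤_) (absorb w (v ++ u) Swvu N≤w)
        (subst (λ z → δ u ≤ δ z) (++-assoc w v u) (δ-monoˡ (w ++ v) u))
    none : ∀ {w} → S w → suc N ≤ length w → noPrefix w ≡ 0
    none {a ∷ w} Saw (s≤s N≤w) = ℕ.+-cancelʳ-≡ (δ w) _ 0 (ℕ.≤-antisym
      (peak Saw (drop-++ factorial (a ∷ []) Saw) N≤w) (δ-monoˡ (a ∷ []) w))

  stable : ∃ Stable
  stable with complete
  ... | inj₁ pc = N , prefix-stable pc
  ... | inj₂ sc = suc N , suffix-stable sc

  long-word : S [] → ∀ n → ∃ λ w → S w × n ≤ length w
  long-word S[] zero  = [] , S[] , z≤n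
  long-word S[] (suc n) with w , Sw , n≤w ← long-word S[] n with (a , b) , Sawb ← extendable Sw =
    a ∷ w , take-++ factorial (b ∷ []) Sawb , s≤s n≤w

  degree : S [] → ∃ λ d → IsDegree S X d × (∃ λ M →
             (∀ {w} → S w → M ≤ length w → δ w ≡ d) × (∀ {w} → S w → M ≤ length w → noPrefix w ≡ 0))
  degree S[] with M , st ← stable with w , Sw , M≤w ← long-word S[] M =
    δ w
    , record
        { attained = w , Sw , parse-count w
        ; bound    = λ {u} Su card →
            ℕ.≤-trans (ℕ.≤-reflexive (HasCard-unique card (parse-count u))) (δ-peak Su Sw M≤w)
        }
    , M , (λ Su M≤u → δ-constant Su M≤u Sw M≤w) , noPrefix≡0
    where open Stable st

-- Counting the codewords along the prefix tree.

module _ {k : ℕ} where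

  words≤ : ℕ → List (Word (Fin k))
  words≤ zero  = words 0
  words≤ (suc n) = words (suc n) ++ words≤ n

  ∈-words≤⁻ : ∀ n {w} → w ∈ words≤ n → length w ≤ n
  ∈-words≤⁻ zero  w∈ = ℕ.≤-reflexive (∈-words⁻ 0 w∈)
  ∈-words≤⁻ (suc n) w∈ with ∈-++⁻ (words (suc n)) w∈
  ... | inj₁ w∈ = ℕ.≤-reflexive (∈-words⁻ (suc n) w∈)
  ... | inj₂ w∈ = ℕ.m≤n⇒m≤1+n (∈-words≤⁻ n w∈)

  ∈-words≤⁺ : ∀ n {w} → length w ≤ n → w ∈ words≤ n
  ∈-words≤⁺ zero  {[]} _ = here refl
  ∈-words≤⁺ (suc n) {w} w≤ with ℕ.m≤n⇒m<n∨m≡n w≤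
  ... | inj₁ (s≤s w≤n) = ∈-++⁺ʳ (words (suc n)) (∈-words≤⁺ n w≤n)
  ... | inj₂ eq        = ∈-++⁺ˡ (subst (λ m → w ∈ words m) eq (∈-words⁺ w))

  words≤-unique : ∀ n → Unique (words≤ n)
  words≤-unique zero  = words-unique 0
  words≤-unique (suc n) = Unique.++⁺ (words-unique (suc n)) (words≤-unique n)
    λ (p , q) → ℕ.<-irrefl refl (subst (_≤ n) (∈-words⁻ (suc n) p) (∈-words≤⁻ n q))

  module Count {c} (S : Pred (Word (Fin k)) 0ℓ) (treeSet : IsTreeSet S c) (S? : Decidable S) (S[] : S [])
               {X : Pred (Word (Fin k)) 0ℓ} (bifix : IsBifixCode X) (X⊆S : X ⊆ S)
               (xs : List (Word (Fin k))) (xs! : Unique xs) (X≐xs : X ≐ (_∈ xs)) where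
    open IsTreeSet treeSet
    open TreeSet S treeSet
    open Code Fin._≟_ bifix xs X≐xs

    private
      A : List (Fin k)
      A = allFin k

      ρ′ : Word (Fin k) → ℤ
      ρ′ = ρ S?

    ρ-total : ∀ n → ∑ (words (suc n)) ρ′ ≡ + k - + c
    ρ-total zero    = trans (∑-words-∷ 0 ρ′) (trans (+-identityʳ _) (ρ-letters S?))
    ρ-total (suc n) = begin
      ∑ (words (suc (suc n))) ρ′                         ≡⟨ ∑-words-∷ (suc n) ρ′ ⟩
      ∑ (words (suc n)) (λ w → ∑ A (λ a → ρ′ (a ∷ w)))
        ≡⟨ ∑-cong (words (suc n)) (λ {w} w∈ → ρ-harmonic S? w λ { refl → ℕ.0≢1+n (∈-words⁻ (suc n) w∈) }) ⟩
      ∑ (words (suc n)) ρ′                               ≡⟨ ρ-total n ⟩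
      + k - + c                                          ∎

    -- In the prefix tree of `X` inside `S`, `survivors n` is the frontier at depth `n` not yet cut
    -- off by a codeword.
    ρδ ρπ survivors codewords : ℕ → ℤ
    ρδ n = ∑ (words n) (λ w → + δ w * ρ′ w)
    ρπ n = ∑ (words n) (λ w → + noPrefix w * ρ′ w)
    survivors n = ∑ (words n) (λ w → + noPrefix w * 𝟙 (S? w))
    codewords n = ∑ (words≤ n) (𝟙 ∘ X?)

    -- The recursion for δ is weighted by ρ. The inner sum of ρ stays unevaluated because its value
    -- at the empty word differs from the harmonic one.
    ρδ-suc : ∀ n → ρδ (suc n) ≡ ρπ (suc n) + ∑ (words n) (λ w → + δ w * ∑ A (λ a → ρ′ (a ∷ w)))
    ρδ-suc n = begin
      ρδ (suc n)                                                         ≡⟨ ∑-words-∷ n _ ⟩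
      ∑ (words n) (λ w → ∑ A (λ a → + δ (a ∷ w) * ρ′ (a ∷ w)))
        ≡⟨ ∑-cong (words n) (λ {w} _ → step w) ⟩
      ∑ (words n) (λ w → ∑ A (λ a → + noPrefix (a ∷ w) * ρ′ (a ∷ w)) + + δ w * ∑ A (λ a → ρ′ (a ∷ w)))
        ≡⟨ ∑-distrib-+ (words n) _ _ ⟩
      ∑ (words n) (λ w → ∑ A (λ a → + noPrefix (a ∷ w) * ρ′ (a ∷ w))) + rest
        ≡⟨ cong (_+ rest) (∑-words-∷ n _) ⟨
      ρπ (suc n) + rest                                                  ∎
      where
      rest = ∑ (words n) (λ w → + δ w * ∑ A (λ a → ρ′ (a ∷ w)))

      step : ∀ w → ∑ A (λ a → + δ (a ∷ w) * ρ′ (a ∷ w)) ≡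
                   ∑ A (λ a → + noPrefix (a ∷ w) * ρ′ (a ∷ w)) + + δ w * ∑ A (λ a → ρ′ (a ∷ w))
      step w = begin
        ∑ A (λ a → + δ (a ∷ w) * ρ′ (a ∷ w))
          ≡⟨ ∑-cong A (λ {a} _ → *-distribʳ-+ (ρ′ (a ∷ w)) (+ noPrefix (a ∷ w)) (+ δ w)) ⟩
        ∑ A (λ a → + noPrefix (a ∷ w) * ρ′ (a ∷ w) + + δ w * ρ′ (a ∷ w))
          ≡⟨ ∑-distrib-+ A _ _ ⟩
        ∑ A (λ a → + noPrefix (a ∷ w) * ρ′ (a ∷ w)) + ∑ A (λ a → + δ w * ρ′ (a ∷ w))
          ≡⟨ cong (_+_ (∑ A _)) (*-distribˡ-∑ (+ δ w) A _) ⟨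
        ∑ A (λ a → + noPrefix (a ∷ w) * ρ′ (a ∷ w)) + + δ w * ∑ A (λ a → ρ′ (a ∷ w)) ∎

    -- A survivor `w` has `∣R∣ w` children in `S`, each a survivor or a codeword. Replacing `w` by
    -- its children therefore changes the total by `ρ w`; words with a prefix in `X` contribute
    -- nothing.
    survivors-suc : ∀ n → survivors (suc n) + codewords (suc n) ≡ survivors n + codewords n + ρπ n
    survivors-suc n = begin
      survivors (suc n) + codewords (suc n)
        ≡⟨ cong (_+_ (survivors (suc n))) (∑-++ (words (suc n)) (words≤ n) _) ⟩
      survivors (suc n) + (∑ (words (suc n)) (𝟙 ∘ X?) + codewords n)
        ≡⟨ +-assoc (survivors (suc n)) _ _ ⟨
      survivors (suc n) + ∑ (words (suc n)) (𝟙 ∘ X?) + codewords n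
        ≡⟨ cong (_+ codewords n) (∑-distrib-+ (words {k} (suc n)) _ _) ⟨
      ∑ (words (suc n)) (λ w → + noPrefix w * 𝟙 (S? w) + 𝟙 (X? w)) + codewords n
        ≡⟨ cong (_+ codewords n) (∑-words-∷ʳ n _) ⟩
      ∑ (words n) (λ w → ∑ A (λ a → + noPrefix (w ∷ʳ a) * 𝟙 (S? (w ∷ʳ a)) + 𝟙 (X? (w ∷ʳ a)))) + codewords n
        ≡⟨ cong (_+ codewords n) (∑-cong (words n) (λ {w} _ →
             trans (∑-cong A (λ {a} _ → letter w a)) (sym (*-distribˡ-∑ (+ noPrefix w) A _)))) ⟩
      ∑ (words n) (λ w → + noPrefix w * ∣R∣ S? w) + codewords n
        ≡⟨ cong (_+ codewords n) (trans
             (∑-cong (words n) (λ {w} _ → split (+ noPrefix w) (𝟙 (S? w)) (∣R∣ S? w)))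
             (∑-distrib-+ (words n) _ _)) ⟩
      survivors n + ρπ n + codewords n
        ≡⟨ swap-right (survivors n) (ρπ n) (codewords n) ⟩
      survivors n + codewords n + ρπ n ∎
      where
      letter : ∀ w a → + noPrefix (w ∷ʳ a) * 𝟙 (S? (w ∷ʳ a)) + 𝟙 (X? (w ∷ʳ a)) ≡ + noPrefix w * 𝟙 (S? (w ∷ʳ a))
      letter w a = begin
        + noPrefix (w ∷ʳ a) * 𝟙 (S? (w ∷ʳ a)) + 𝟙 (X? (w ∷ʳ a))
          ≡⟨ cong (_+_ (+ noPrefix (w ∷ʳ a) * 𝟙 (S? (w ∷ʳ a)))) X⊆S-𝟙 ⟩
        + noPrefix (w ∷ʳ a) * 𝟙 (S? (w ∷ʳ a)) + 𝟙 (X? (w ∷ʳ a)) * 𝟙 (S? (w ∷ʳ a))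
          ≡⟨ *-distribʳ-+ (𝟙 (S? (w ∷ʳ a))) (+ noPrefix (w ∷ʳ a)) (𝟙 (X? (w ∷ʳ a))) ⟨
        (+ noPrefix (w ∷ʳ a) + 𝟙 (X? (w ∷ʳ a))) * 𝟙 (S? (w ∷ʳ a))
          ≡⟨ cong (λ n → + n * 𝟙 (S? (w ∷ʳ a))) (noPrefix-∷ʳ w a) ⟩
        + noPrefix w * 𝟙 (S? (w ∷ʳ a)) ∎
        where
        X⊆S-𝟙 : 𝟙 (X? (w ∷ʳ a)) ≡ 𝟙 (X? (w ∷ʳ a)) * 𝟙 (S? (w ∷ʳ a))
        X⊆S-𝟙 with X? (w ∷ʳ a)
        ... | yes Xwa = sym (trans (*-identityˡ _) (𝟙-yes (S? (w ∷ʳ a)) (X⊆S Xwa)))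
        ... | no _    = sym (*-zeroˡ (𝟙 (S? (w ∷ʳ a))))
      split : ∀ p s r → p * r ≡ p * s + p * (r - s)
      split = solve-∀
      swap-right : ∀ x y z → x + y + z ≡ x + z + y
      swap-right = solve-∀

    -- Each step adds the same term `ρπ` to both sides; the tree side runs one level ahead because
    -- `survivors-suc` uses the weights of the parents and `ρδ-suc` those of the children. The
    -- summand `c` comes from the root: ρ is `k - 1` at the empty word, whereas the letters have
    -- total `k - c`.
    balance : ∀ n → survivors (suc (suc n)) + codewords (suc (suc n)) ≡ ρδ (suc n) + + c
    balance zero = begin
      survivors 2 + codewords 2                      ≡⟨ survivors-suc 1 ⟩
      survivors 1 + codewords 1 + ρπ 1               ≡⟨ cong (_+ ρπ 1) (survivors-suc 0) ⟩
      survivors 0 + codewords 0 + ρπ 0 + ρπ 1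
        ≡⟨ cong (_+ ρπ 1) (cong₂ _+_ (cong₂ _+_ survivors-0 codewords-0) ρπ-0) ⟩
      1ℤ + 0ℤ + (+ k - 1ℤ) + ρπ 1                    ≡⟨ arith (+ k) (+ c) (ρπ 1) ⟩
      ρπ 1 + (+ k - + c) + + c                       ≡⟨ cong (λ x → ρπ 1 + x + + c) first ⟨
      ρπ 1 + ∑ (words 0) (λ w → + δ w * ∑ A (λ a → ρ′ (a ∷ w))) + + c
                                                     ≡⟨ cong (_+ + c) (ρδ-suc 0) ⟨
      ρδ 1 + + c                                     ∎
      where
      arith : ∀ k c v → 1ℤ + 0ℤ + (k - 1ℤ) + v ≡ v + (k - c) + c
      arith = solve-∀
      survivors-0 : survivors 0 ≡ 1ℤ
      survivors-0 rewrite noPrefix-[] | ι-yes (S? []) S[] = refl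
      codewords-0 : codewords 0 ≡ 0ℤ
      codewords-0 rewrite ι-no (X? []) (IsBifixCode.nonempty bifix) = refl
      ρ-[] : ρ′ [] ≡ + k - 1ℤ
      ρ-[] = cong₂ _-_ (trans (∑-cong A (λ {a} _ → 𝟙-yes (S? (a ∷ [])) (IsFactorial.letters factorial a)))
        (trans (∑-one A) (cong +_ (length-tabulate {n = k} id)))) (𝟙-yes (S? []) S[])
      ρπ-0 : ρπ 0 ≡ + k - 1ℤ
      ρπ-0 = trans (+-identityʳ _) (trans (cong₂ _*_ (cong +_ noPrefix-[]) ρ-[]) (*-identityˡ (+ k - 1ℤ)))
      first : ∑ (words 0) (λ w → + δ w * ∑ A (λ a → ρ′ (a ∷ w))) ≡ + k - + c
      first = trans (+-identityʳ _) (trans (*-identityˡ _) (ρ-letters S?))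
    balance (suc n) = begin
      survivors (3 ℕ.+ n) + codewords (3 ℕ.+ n)                ≡⟨ survivors-suc (suc (suc n)) ⟩
      survivors (2 ℕ.+ n) + codewords (2 ℕ.+ n) + ρπ (2 ℕ.+ n) ≡⟨ cong (_+ ρπ (2 ℕ.+ n)) (balance n) ⟩
      ρδ (suc n) + + c + ρπ (2 ℕ.+ n)                          ≡⟨ arith (ρδ (suc n)) (+ c) (ρπ (2 ℕ.+ n)) ⟩
      ρπ (2 ℕ.+ n) + ρδ (suc n) + + c
        ≡⟨ cong (λ x → ρπ (2 ℕ.+ n) + x + + c) (∑-cong (words (suc n)) (λ {w} w∈ → cong (_*_ (+ δ w))
             (ρ-harmonic S? w λ { refl → ℕ.0≢1+n (∈-words⁻ (suc n) w∈) }))) ⟨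
      ρπ (2 ℕ.+ n) + ∑ (words (suc n)) (λ w → + δ w * ∑ A (λ a → ρ′ (a ∷ w))) + + c
        ≡⟨ cong (_+ + c) (ρδ-suc (suc n)) ⟨
      ρδ (2 ℕ.+ n) + + c                                       ∎
      where
      arith : ∀ u c v → u + c + v ≡ v + u + c
      arith = solve-∀

    codewords-all : ∀ n → (∀ {x} → X x → length x ≤ n) → codewords n ≡ + length xs
    codewords-all n short = trans (sym (∑-filter X? (words≤ n))) (cong +_ (HasCard-unique {P = X}
      (filter X? (words≤ n) , Unique.filter⁺ X? (words≤-unique n)
        , ((λ Xx → ∈-filter⁺ X? (∈-words≤⁺ n (short Xx)) Xx)
          , λ x∈ → proj₂ (∈-filter⁻ X? {xs = words≤ n} x∈)) , refl)
      (xs , xs! , X≐xs , refl)))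

    -- `balance M` concerns the depths `2 + M` and `suc M`, both beyond the threshold: no survivors
    -- remain, all codewords have been met, and δ is the constant `d`.
    card : ∀ {d M} → (∀ {x} → X x → length x ≤ M) →
           (∀ {w} → S w → M ≤ length w → δ w ≡ d) → (∀ {w} → S w → M ≤ length w → noPrefix w ≡ 0) →
           + length xs ≡ + d * (+ k - + c) + + c
    card {d} {M} short δ≡d none = begin
      + length xs                                              ≡⟨ +-identityˡ _ ⟨
      0ℤ + + length xs
        ≡⟨ cong₂ _+_ no-survivors (codewords-all (2 ℕ.+ M) (ℕ.m≤n⇒m≤o+n 2 ∘ short)) ⟨
      survivors (2 ℕ.+ M) + codewords (2 ℕ.+ M)                ≡⟨ balance M ⟩
      ρδ (suc M) + + c                                         ≡⟨ cong (_+ + c) ρδ≡ ⟩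
      + d * (+ k - + c) + + c                                  ∎
      where
      no-survivors : survivors (2 ℕ.+ M) ≡ 0ℤ
      no-survivors = trans (∑-cong (words (2 ℕ.+ M)) (λ {w} w∈ → vanish w (ℕ.≤-trans (ℕ.m≤n+m M 2)
        (ℕ.≤-reflexive (sym (∈-words⁻ (2 ℕ.+ M) w∈)))))) (∑-zero (words {k} (2 ℕ.+ M)))
        where
        vanish : ∀ w → M ≤ length w → + noPrefix w * 𝟙 (S? w) ≡ 0ℤ
        vanish w M≤w with S? w
        ... | yes Sw = cong (λ p → + p * 1ℤ) (none Sw M≤w)
        ... | no _   = *-zeroʳ (+ noPrefix w)
      ρδ≡ : ρδ (suc M) ≡ + d * (+ k - + c)
      ρδ≡ = begin
        ρδ (suc M)
          ≡⟨ ∑-cong (words (suc M)) (λ {w} w∈ → const w (ℕ.≤-trans (ℕ.n≤1+n M)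
               (ℕ.≤-reflexive (sym (∈-words⁻ (suc M) w∈))))) ⟩
        ∑ (words (suc M)) (λ w → + d * ρ′ w)  ≡⟨ *-distribˡ-∑ (+ d) (words (suc M)) ρ′ ⟨
        + d * ∑ (words (suc M)) ρ′            ≡⟨ cong (_*_ (+ d)) (ρ-total M) ⟩
        + d * (+ k - + c)                     ∎
        where
        const : ∀ w → M ≤ length w → + δ w * ρ′ w ≡ + d * ρ′ w
        -- The value of δ is controlled only on `S`; elsewhere ρ vanishes and both products are
        -- zero.
        const w M≤w = [ (λ Sw → cong (λ n → + n * ρ′ w) (δ≡d Sw M≤w)) , (λ ¬Sw →
          trans (cong (_*_ (+ δ w)) (ρ-∉ S? ¬Sw)) (trans (*-zeroʳ (+ δ w))
            (sym (trans (cong (_*_ (+ d)) (ρ-∉ S? ¬Sw)) (*-zeroʳ (+ d)))))) ]′ (toSum (S? w))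

theorem4p16 : ∀ (k : ℕ) (θ : Fin k → Fin k) → Involutive _≡_ θ →
    (S : Pred (Word (Fin k)) 0ℓ) → IsSpecular θ S → IsRecurrent S →
    (X : Pred (Word (Fin k)) 0ℓ) → IsMaximalBifixCode S X →
    (n : ℕ) → HasCard X n →
    ∃ λ d → IsDegree S X d × + n ≡ + d * (+ k - + 2) + + 2
theorem4p16 k θ _ S specular isRecurrent X isMaximal n (xs , xs! , X≐xs , refl) =
  let d , isDegree , M , δ≡d , none = degree S[]
  -- The maximum of `M` and `N` serves both purposes: δ is stable from `M` on, and codewords are
  -- shorter than `N`.
  in d , isDegree , card {d} {M ℕ.⊔ N} (λ Xx → ℕ.≤-trans (ℕ.<⇒≤ (X-short Xx)) (ℕ.m≤n⊔m M N))
       (λ Sw → δ≡d Sw ∘ ℕ.m⊔n≤o⇒m≤o M N) (λ Sw → none Sw ∘ ℕ.m⊔n≤o⇒m≤o M N)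
  where
  treeSet = IsSpecular.treeSet specular
  open IsTreeSet treeSet using (biextendable; factorial; forest)
  open IsMaximalBifixCode isMaximal
  -- A tree of the extension graph of the empty word has a vertex, hence there is a letter, and the
  -- empty word is a factor of it.
  some-letter : Fin k ⊎ Fin k
  some-letter = proj₁ (IsTree.nonempty (IsDisjointUnionOfTrees.trees forest Fin.zero))
  S[] : S []
  S[] = [ (λ a → drop-++ factorial (a ∷ []) (IsFactorial.letters factorial a))
        , (λ a → drop-++ factorial (a ∷ []) (IsFactorial.letters factorial a)) ]′ some-letter
  S? : Decidable S
  S? = TreeSet.language? S treeSet S[]
  open Maximal S? biextendable isRecurrent isMaximal xs X≐xs
  open Count S treeSet S? S[] bifix included xs xs! X≐xs
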